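{- For each integer $k>0$ there is $\ell_0\in\mathbb{Z}^+$ such that for all $\ell>\ell_0$ and every monotone arithmetic circuit $C$ of width $k$ with $\mathrm{mon}(C)\subseteq\mathrm{mon}(P^\ell_k)$ and $|\mathrm{mon}(C)|\ge |\mathrm{mon}(P^\ell_k)|/2$, the size of $C$ is at least $2^\ell/10$.
   Context: For positive integers $k,\ell$ define the commutative polynomial $P^\ell_k\in\mathbb{R}[x_1,\dots,x_{\ell^{2k}}]$ by $P^\ell_1(x_1,\dots,x_{\ell^2})=\sum_{i=1}^\ell\prod_{j=1}^\ell x_{(i-1)\ell+j}$ and $P^\ell_{k+1}(x_1,\dots,x_{\ell^{2k+2}})=\sum_{i=1}^\ell\prod_{j=1}^\ell P^\ell_k(x_{(i-1)\ell^{2k+1}+(j-1)\ell^{2k}+1},\dots,x_{(i-1)\ell^{2k+1}+j\ell^{2k}})$. For a polynomial $q$, $\mathrm{mon}(q)$ is its set of monomials with nonzero coefficient; $\mathrm{mon}(C)$ is this set for the polynomial computed by circuit $C$. An arithmetic circuit has leaves labeled by variables or constants and internal $+$/$\times$ gates of indegree two; it is layered if its nodes are partitioned into layers $V_1,\dots,V_t$ with $V_1$ all leaves and children of a node in $V_i$ ($i>1$) lying in $V_1\cup V_{i-1}$; size is the number of nodes and width is $\max_{i>1}|V_i|$. It is monotone if it is over $\mathbb{R}$ and all constants are nonnegative.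
   Formalization: The constants of the monotone circuit, and the coefficients of the polynomials, are nonnegative rational numbers instead of nonnegative real numbers. -}

module Defs where

open import Data.Nat as ℕ using (ℕ; zero; suc; _≡ᵇ_; _⊔_)
open import Data.Nat.Properties using ()
open import Data.Fin using (Fin; toℕ)
open import Data.Bool using (Bool; true; false; if_then_else_)
open import Data.List as List using (List; []; _∷_; _++_; concatMap; filter; deduplicate; length; upTo)
open import Data.Vec as Vec using (Vec; tabulate; replicate; zipWith; lookup)
import Data.Vec.Properties as VecP
open import Data.Product using (_×_; _,_; proj₁)
open import Data.Rational as ℚ using (ℚ; 0ℚ; 1ℚ)
import Data.Rational.Properties as ℚP
open import Relation.Nullary using (¬_; ¬?; Dec; yes; no)
open import Relation.Binary.PropositionalEquality using (_≡_)

-- Commutative polynomials over ℚ in N variables x_0 … x_{N-1}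
-- (0-based indexing of variables; the paper uses 1-based).
-- A monomial is an exponent vector; a polynomial is a finite formal
-- list of terms (monomial , coefficient); its actual coefficient at a
-- monomial m is the sum of the coefficients of all terms with monomial m.

Mono : ℕ → Set
Mono N = Vec ℕ N

Poly : ℕ → Set
Poly N = List (Mono N × ℚ)

_≟m_ : ∀ {N} → (m m' : Mono N) → Dec (m ≡ m')
_≟m_ = VecP.≡-dec ℕ._≟_

zeroP : ∀ {N} → Poly N
zeroP = []

constP : ∀ {N} → ℚ → Poly N
constP {N} c = (replicate N 0 , c) ∷ []

varP : ∀ {N} → ℕ → Poly N
varP {N} i = (tabulate (λ j → if toℕ j ≡ᵇ i then 1 else 0) , 1ℚ) ∷ []

_⊕_ : ∀ {N} → Poly N → Poly N → Poly N
p ⊕ q = p ++ q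

_⊗_ : ∀ {N} → Poly N → Poly N → Poly N
p ⊗ q = concatMap (λ { (m , a) → List.map (λ { (m' , b) → (zipWith ℕ._+_ m m' , a ℚ.* b) }) q }) p

coeff : ∀ {N} → Poly N → Mono N → ℚ
coeff [] m = 0ℚ
coeff ((m' , a) ∷ p) m with m' ≟m m
... | yes _ = a ℚ.+ coeff p m
... | no  _ = coeff p m

_∈mon_ : ∀ {N} → Mono N → Poly N → Set
m ∈mon p = ¬ (coeff p m ≡ 0ℚ)

_⊆mon_ : ∀ {N} → Poly N → Poly N → Set
p ⊆mon q = ∀ m → m ∈mon p → m ∈mon q

monList : ∀ {N} → Poly N → List (Mono N)
monList p = deduplicate _≟m_ (filter (λ m → ¬? (coeff p m ℚP.≟ 0ℚ)) (List.map proj₁ p))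

numMon : ∀ {N} → Poly N → ℕ
numMon p = length (monList p)

ΣP : ∀ {N} → List (Poly N) → Poly N
ΣP = List.foldr _⊕_ zeroP

ΠP : ∀ {N} → List (Poly N) → Poly N
ΠP = List.foldr _⊗_ (constP 1ℚ)

-- The polynomials P^ℓ_k.  Ppoly ℓ k off is P^ℓ_k applied to the block of
-- variables x_off, …, x_{off + ℓ^{2k} - 1} (0-based).  Only k ≥ 1 is meaningful.

Ppoly : ∀ {N} → (ℓ k off : ℕ) → Poly N
Ppoly ℓ zero off = zeroP   -- unused (k ≥ 1)
Ppoly ℓ (suc zero) off =
  ΣP (List.map (λ i → ΠP (List.map (λ j → varP (off ℕ.+ i ℕ.* ℓ ℕ.+ j)) (upTo ℓ))) (upTo ℓ))
Ppoly ℓ (suc (suc k)) off =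
  ΣP (List.map (λ i → ΠP (List.map (λ j →
      Ppoly ℓ (suc k) (off ℕ.+ (i ℕ.* ℓ ℕ.+ j) ℕ.* (ℓ ℕ.^ (2 ℕ.* suc k)))) (upTo ℓ))) (upTo ℓ))

P : (ℓ k : ℕ) → Poly (ℓ ℕ.^ (2 ℕ.* k))
P ℓ k = Ppoly ℓ k 0

-- Layered arithmetic circuits.
-- Layer V_1 = the m₁ leaves; layers V_2, …, V_t are lists of gates of
-- indegree two whose children lie in V_1 ∪ V_{i-1}.

data Leaf (N : ℕ) : Set where
  var   : Fin N → Leaf N
  const : ℚ → Leaf N

data Op : Set where
  plus times : Op

-- a child of a gate in layer V_i: a leaf (in V_1) or a node of V_{i-1}
-- (p = |V_{i-1}| for i ≥ 3, and p = 0 for i = 2 since then V_{i-1} = V_1)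
data Child (m₁ p : ℕ) : Set where
  leafC : Fin m₁ → Child m₁ p
  prevC : Fin p → Child m₁ p

record Gate (m₁ p : ℕ) : Set where
  constructor gate
  field
    op    : Op
    left  : Child m₁ p
    right : Child m₁ p

-- the sequence of layers V_i, V_{i+1}, …, V_t, given p = size of previous gate layer
data Layers (m₁ : ℕ) : ℕ → Set where
  []  : ∀ {p} → Layers m₁ p
  _∷_ : ∀ {p w} → Vec (Gate m₁ p) w → Layers m₁ w → Layers m₁ p

layersSize : ∀ {m₁ p} → Layers m₁ p → ℕ
layersSize [] = 0
layersSize (_∷_ {w = w} _ L) = w ℕ.+ layersSize L

layersWidth : ∀ {m₁ p} → Layers m₁ p → ℕ
layersWidth [] = 0
layersWidth (_∷_ {w = w} _ L) = w ⊔ layersWidth L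

record Circuit (N : ℕ) : Set where
  field
    m₁     : ℕ
    leaves : Vec (Leaf N) m₁
    layers : Layers m₁ 0
    output : Fin (m₁ ℕ.+ layersSize layers)

open Circuit public

size : ∀ {N} → Circuit N → ℕ
size C = m₁ C ℕ.+ layersSize (layers C)

width : ∀ {N} → Circuit N → ℕ
width C = layersWidth (layers C)

Monotone : ∀ {N} → Circuit N → Set
Monotone C = ∀ i c → lookup (leaves C) i ≡ const c → 0ℚ ℚ.≤ c

leafPoly : ∀ {N} → Leaf N → Poly N
leafPoly (var i)   = varP (toℕ i)
leafPoly (const c) = constP c

opPoly : ∀ {N} → Op → Poly N → Poly N → Poly N
opPoly plus  = _⊕_
opPoly times = _⊗_

childPoly : ∀ {N m₁ p} → Vec (Poly N) m₁ → Vec (Poly N) p → Child m₁ p → Poly N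
childPoly lv pv (leafC i) = lookup lv i
childPoly lv pv (prevC i) = lookup pv i

gatePoly : ∀ {N m₁ p} → Vec (Poly N) m₁ → Vec (Poly N) p → Gate m₁ p → Poly N
gatePoly lv pv (gate o l r) = opPoly o (childPoly lv pv l) (childPoly lv pv r)

evalLayers : ∀ {N m₁ p} → Vec (Poly N) m₁ → Vec (Poly N) p → (L : Layers m₁ p) →
             Vec (Poly N) (layersSize L)
evalLayers lv pv [] = Vec.[]
evalLayers lv pv (layer ∷ L) =
  let cur = Vec.map (gatePoly lv pv) layer in cur Vec.++ evalLayers lv cur L

circuitPoly : ∀ {N} → Circuit N → Poly N
circuitPoly C =
  let lv = Vec.map leafPoly (leaves C) in
  lookup (lv Vec.++ evalLayers lv Vec.[] (layers C)) (output C)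

{-# OPTIONS --safe #-}

-- Coefficients are nonnegative, so supports never cancel and only sets of
-- monomials matter: sums are unions and products are Minkowski products.
--
-- Induction on the width.  Follow a monomial of the output of a circuit for
-- P^ℓ_{k+1} downwards, through sums and through products with constants, until a
-- product of two nonconstant sets is reached: all monomials of that gate come from
-- one of the ℓ terms of the outer sum.  Choose the monomial m for which this
-- happens in the lowest layer.  Every layer above contains a gate carrying m, which
-- is useless for the gates belonging to other terms, and the nonconstant gates of
-- that lowest layer serve at most k + 1 terms.  So the gates of the other terms are
-- computed with width k above that layer.  By induction each of their projections to
-- a factor P^ℓ_k has density below 1/2, hence each of them has density at most 2^-ℓ
-- in its term, and about 2^ℓ of them are needed.
module Submission where

open import Defs
open import Data.Nat using (ℕ; zero; suc; _<_; _≤_; _*_; _^_; _+_; z≤n; s≤s; _≤?_; _<?_; _≡ᵇ_)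
import Data.Nat as ℕ
open import Data.Nat.Properties
open import Data.Nat.Tactic.RingSolver using (solve-∀)
open import Data.Bool using (Bool; true; false; if_then_else_; T)
open import Data.Fin using (Fin; zero; suc; toℕ)
import Data.Fin as Fin
import Data.Fin.Properties as FinP
open import Data.Rational as ℚ using (ℚ; 0ℚ; 1ℚ)
import Data.Rational.Properties as ℚP
open import Data.Vec using (Vec; []; _∷_; lookup; tabulate; replicate; zipWith)
import Data.Vec as Vec
import Data.Vec.Properties as VecP
open import Data.List using (List; []; _∷_; [_]; _++_; map; concat; foldr; length; upTo; cartesianProductWith; deduplicate)
import Data.List as List
import Data.List.Properties as ListP
open import Data.List.Relation.Unary.All as All using (All; []; _∷_)
import Data.List.Relation.Unary.All.Properties as AllP
open import Data.List.Relation.Unary.Any as Any using (here; there)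
open import Data.List.Relation.Unary.AllPairs using ([]; _∷_)
open import Data.List.Relation.Unary.Unique.Propositional using (Unique)
import Data.List.Relation.Unary.Unique.Propositional.Properties as UniqueP
import Data.List.Relation.Unary.Unique.DecPropositional.Properties as UniqueDecP
open import Data.List.Membership.Propositional using (_∈_; _∉_; find)
open import Data.List.Membership.Propositional.Properties
open import Data.List.Membership.DecPropositional ℕ._≟_ using () renaming (_∈?_ to _∈ℕ?_)
import Data.List.Membership.DecPropositional as DecMembership
open import Data.List.Relation.Binary.Subset.Propositional using (_⊆_)
open import Data.List.Relation.Binary.Disjoint.Propositional using (Disjoint)
open import Data.Product using (Σ; _×_; _,_; proj₁; proj₂)
open import Data.Sum using (_⊎_; inj₁; inj₂; [_,_]′)
open import Data.Empty using (⊥-elim)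
open import Data.Unit using (⊤; tt)
open import Function using (_∘_; id)
open import Relation.Nullary using (¬_; Dec; yes; no; does; ¬?; contradiction)
open import Relation.Nullary.Decidable using (_×-dec_; _→-dec_; decidable-stable)
open import Relation.Binary.PropositionalEquality hiding ([_])
open import Relation.Binary.Definitions using (tri<; tri≈; tri>)

-- Counting in duplicate-free lists

unique-⊆-length : ∀ {A : Set} {xs ys : List A} → Unique xs → xs ⊆ ys → length xs ≤ length ys
unique-⊆-length [] _ = z≤n
unique-⊆-length {xs = x ∷ xs} (x∉xs ∷ xs!) sub with ∈-∃++ (sub (here refl))
... | as , bs , refl = begin
  suc (length xs)             ≤⟨ s≤s (unique-⊆-length xs! sub′) ⟩
  suc (length (as ++ bs))     ≡⟨ cong suc (ListP.length-++ as) ⟩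
  suc (length as + length bs) ≡⟨ +-suc (length as) (length bs) ⟨
  length as + suc (length bs) ≡⟨ ListP.length-++ as ⟨
  length (as ++ x ∷ bs)       ∎
  where
  open ≤-Reasoning
  sub′ : xs ⊆ as ++ bs
  sub′ z∈xs with ∈-++⁻ as (sub (there z∈xs))
  ... | inj₁ z∈as         = ∈-++⁺ˡ z∈as
  ... | inj₂ (here z≡x)   = contradiction (sym z≡x) (All.lookup x∉xs z∈xs)
  ... | inj₂ (there z∈bs) = ∈-++⁺ʳ as z∈bs

map-unique-on : ∀ {A B : Set} {f : A → B} {xs} → (∀ {x y} → x ∈ xs → y ∈ xs → f x ≡ f y → x ≡ y) →
                Unique xs → Unique (map f xs)
map-unique-on inj [] = []
map-unique-on inj (x∉xs ∷ xs!) =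
  AllP.map⁺ (All.tabulate (λ y∈xs fx≡fy → All.lookup x∉xs y∈xs (inj (here refl) (there y∈xs) fx≡fy)))
  ∷ map-unique-on (λ x∈ y∈ → inj (there x∈) (there y∈)) xs!

∈-concat-map⁺ : ∀ {A B : Set} (F : B → List A) {i is x} → i ∈ is → x ∈ F i → x ∈ concat (map F is)
∈-concat-map⁺ F i∈ x∈ = ∈-concat⁺′ x∈ (∈-map⁺ F i∈)

∈-concat-map⁻ : ∀ {A B : Set} (F : B → List A) is {x} → x ∈ concat (map F is) → Σ B λ i → i ∈ is × x ∈ F i
∈-concat-map⁻ F is x∈ with ∈-concat⁻′ (map F is) x∈
... | ys , x∈ys , ys∈ with ∈-map⁻ F ys∈
... | i , i∈ , refl = i , i∈ , x∈ys

concat-map-unique : ∀ {A : Set} (F : ℕ → List A) {is} → (∀ {i j x} → i ∈ is → j ∈ is → x ∈ F i → x ∈ F j → i ≡ j) →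
                    (∀ i → i ∈ is → Unique (F i)) → Unique is → Unique (concat (map F is))
concat-map-unique F {[]} disj F! is! = []
concat-map-unique F {i ∷ is} disj F! (i∉is ∷ is!) = UniqueP.++⁺ (F! i (here refl))
  (concat-map-unique F (λ i∈ j∈ → disj (there i∈) (there j∈)) (λ j j∈ → F! j (there j∈)) is!)
  λ { (x∈i , x∈) → let j , j∈ , x∈j = ∈-concat-map⁻ F is x∈ in
        All.lookup i∉is j∈ (disj (here refl) (there j∈) x∈i x∈j) }

length-concat-map : ∀ {A B : Set} (F : B → List A) {c} is → (∀ {i} → i ∈ is → length (F i) ≡ c) →
                    length (concat (map F is)) ≡ length is * c
length-concat-map F [] _ = refl
length-concat-map F (i ∷ is) eq =
  trans (ListP.length-++ (F i)) (cong₂ _+_ (eq (here refl)) (length-concat-map F is (eq ∘ there)))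

-- Monomials and Minkowski products

infixl 7 _·_
_·_ : ∀ {N} → Mono N → Mono N → Mono N
_·_ = zipWith _+_

𝟏 : ∀ {N} → Mono N
𝟏 = replicate _ 0

-- Monomial sets are lists; _⊙_ is the Minkowski product, the support of a
-- product of polynomials with nonnegative coefficients.
infixl 7 _⊙_
_⊙_ : ∀ {N} → List (Mono N) → List (Mono N) → List (Mono N)
_⊙_ = cartesianProductWith _·_

prod : ∀ {N} → List (List (Mono N)) → List (Mono N)
prod = foldr _⊙_ [ 𝟏 ]

module _ {N : ℕ} where

  lookup-· : ∀ (m n : Mono N) v → lookup (m · n) v ≡ lookup m v + lookup n v
  lookup-· m n v = VecP.lookup-zipWith _+_ v m n

  lookup-𝟏 : ∀ (v : Fin N) → lookup 𝟏 v ≡ 0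
  lookup-𝟏 v = VecP.lookup-replicate v 0

  mono-ext : {m n : Mono N} → (∀ v → lookup m v ≡ lookup n v) → m ≡ n
  mono-ext {m} {n} eq = begin
    m                     ≡⟨ VecP.tabulate∘lookup m ⟨
    tabulate (lookup m)   ≡⟨ VecP.tabulate-cong eq ⟩
    tabulate (lookup n)   ≡⟨ VecP.tabulate∘lookup n ⟩
    n                     ∎
    where open ≡-Reasoning

  ·-assoc : (a b c : Mono N) → (a · b) · c ≡ a · (b · c)
  ·-assoc = VecP.zipWith-assoc +-assoc

  ·-comm : (a b : Mono N) → a · b ≡ b · a
  ·-comm = VecP.zipWith-comm +-comm

  ·-identityˡ : (a : Mono N) → 𝟏 · a ≡ a
  ·-identityˡ = VecP.zipWith-identityˡ (λ _ → refl)

  ·-identityʳ : (a : Mono N) → a · 𝟏 ≡ a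
  ·-identityʳ = VecP.zipWith-identityʳ +-identityʳ

  ·-cancelˡ : (a : Mono N) {b c : Mono N} → a · b ≡ a · c → b ≡ c
  ·-cancelˡ a {b} {c} eq = mono-ext λ v → +-cancelˡ-≡ (lookup a v) _ _
    (trans (sym (lookup-· a b v)) (trans (cong (λ m → lookup m v) eq) (lookup-· a c v)))

  ≢𝟏⇒occurs : {m : Mono N} → m ≢ 𝟏 → Σ (Fin N) λ v → lookup m v ≢ 0
  ≢𝟏⇒occurs {m} m≢𝟏 with FinP.any? (λ v → ¬? (lookup m v ℕ.≟ 0))
  ... | yes p = p
  ... | no ¬p = contradiction
    (mono-ext λ v → trans (decidable-stable (lookup m v ℕ.≟ 0) (λ ne → ¬p (v , ne))) (sym (lookup-𝟏 v))) m≢𝟏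

  occurs⇒≢𝟏 : {m : Mono N} {v : Fin N} → lookup m v ≢ 0 → m ≢ 𝟏
  occurs⇒≢𝟏 {v = v} ne refl = ne (lookup-𝟏 v)

  occurs-·ˡ : (m n : Mono N) {v : Fin N} → lookup m v ≢ 0 → lookup (m · n) v ≢ 0
  occurs-·ˡ m n {v} ne eq = ne (m+n≡0⇒m≡0 _ (trans (sym (lookup-· m n v)) eq))

  occurs-·ʳ : (m n : Mono N) {v : Fin N} → lookup n v ≢ 0 → lookup (m · n) v ≢ 0
  occurs-·ʳ m n {v} ne eq = ne (m+n≡0⇒n≡0 (lookup m v) (trans (sym (lookup-· m n v)) eq))

  occurs-·⁻ : (m n : Mono N) {v : Fin N} → lookup (m · n) v ≢ 0 → lookup m v ≢ 0 ⊎ lookup n v ≢ 0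
  occurs-·⁻ m n {v} ne with lookup m v ℕ.≟ 0
  ... | no m≢0 = inj₁ m≢0
  ... | yes m≡0 = inj₂ λ n≡0 → ne (trans (lookup-· m n v) (cong₂ _+_ m≡0 n≡0))

-- Blocks of consecutive variables and restriction to a block

In : ℕ → ℕ → ℕ → Set
In a q v = a ≤ v × v < a + q

in? : ∀ a q v → Dec (In a q v)
in? a q v = (a ≤? v) ×-dec (v <? a + q)

block-≤ : ∀ off q {i j} → i < j → off + i * q + q ≤ off + j * q
block-≤ off q {i} {j} i<j = begin
  off + i * q + q   ≡⟨ +-assoc off _ q ⟩
  off + (i * q + q) ≡⟨ cong (off +_) (+-comm (i * q) q) ⟩
  off + suc i * q   ≤⟨ +-monoʳ-≤ off (*-monoˡ-≤ q i<j) ⟩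
  off + j * q       ∎
  where open ≤-Reasoning

in-unique : ∀ off q {i j v} → In (off + i * q) q v → In (off + j * q) q v → i ≡ j
in-unique off q {i} {j} (l , u) (l′ , u′) with <-cmp i j
... | tri< i<j _ _ = contradiction (<-≤-trans u (≤-trans (block-≤ off q i<j) l′)) (<-irrefl refl)
... | tri≈ _ i≡j _ = i≡j
... | tri> _ _ j<i = contradiction (<-≤-trans u′ (≤-trans (block-≤ off q j<i) l)) (<-irrefl refl)

in-block : ∀ off q {n i v} → i < n → In (off + i * q) q v → In off (n * q) v
in-block off q i<n (l , u) = ≤-trans (m≤m+n off _) l , <-≤-trans u (block-≤ off q i<n)

-- The `ℓ * ℓ` blocks of length `q` are regrouped into `ℓ` blocks of length `ℓ * q`, one for each
-- term of the outer sum.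
subblock-start : ∀ off ℓ q i j → off + (i * ℓ + j) * q ≡ off + i * (ℓ * q) + j * q
subblock-start off ℓ q i j = begin
  off + (i * ℓ + j) * q         ≡⟨ cong (off +_) (*-distribʳ-+ q (i * ℓ) j) ⟩
  off + (i * ℓ * q + j * q)     ≡⟨ cong (λ x → off + (x + j * q)) (*-assoc i ℓ q) ⟩
  off + (i * (ℓ * q) + j * q)   ≡⟨ +-assoc off _ _ ⟨
  off + i * (ℓ * q) + j * q     ∎
  where open ≡-Reasoning

in-subblock : ∀ off ℓ q {i j v} → j < ℓ → In (off + (i * ℓ + j) * q) q v → In (off + i * (ℓ * q)) (ℓ * q) v
in-subblock off ℓ q {i} {j} {v} j<ℓ p = in-block (off + i * (ℓ * q)) q j<ℓ
  (subst (λ a → In a q v) (subblock-start off ℓ q i j) p)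

Within : ∀ {N} → ℕ → ℕ → Mono N → Set
Within a q m = ∀ v → lookup m v ≢ 0 → In a q (toℕ v)

-- The substitution of 1 for every variable outside the interval. Being a monoid homomorphism, it
-- can be carried through a whole circuit.
restrict : ∀ {N} → ℕ → ℕ → Mono N → Mono N
restrict a q m = tabulate λ v → if does (in? a q (toℕ v)) then lookup m v else 0

module _ {N : ℕ} (a q : ℕ) where

  within? : (m : Mono N) → Dec (Within a q m)
  within? m = FinP.all? (λ v → ¬? (lookup m v ℕ.≟ 0) →-dec in? a q (toℕ v))

  lookup-restrict : ∀ (m : Mono N) v → lookup (restrict a q m) v ≡ (if does (in? a q (toℕ v)) then lookup m v else 0)
  lookup-restrict m v = VecP.lookup∘tabulate _ v

  occurs-restrict : ∀ {m : Mono N} {v} → lookup (restrict a q m) v ≢ 0 → lookup m v ≢ 0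
  occurs-restrict {m} {v} ne eq = ne (trans (lookup-restrict m v) (lemma (does (in? a q (toℕ v)))))
    where
    lemma : ∀ b → (if b then lookup m v else 0) ≡ 0
    lemma true = eq
    lemma false = refl

  restrict-· : (m n : Mono N) → restrict a q (m · n) ≡ restrict a q m · restrict a q n
  restrict-· m n = mono-ext λ v → begin
    lookup (restrict a q (m · n)) v                           ≡⟨ lookup-restrict (m · n) v ⟩
    (if does (in? a q (toℕ v)) then lookup (m · n) v else 0)  ≡⟨ lemma v (does (in? a q (toℕ v))) ⟩
    (if does (in? a q (toℕ v)) then lookup m v else 0) +
    (if does (in? a q (toℕ v)) then lookup n v else 0)        ≡⟨ cong₂ _+_ (lookup-restrict m v) (lookup-restrict n v) ⟨
    lookup (restrict a q m) v + lookup (restrict a q n) v     ≡⟨ lookup-· (restrict a q m) (restrict a q n) v ⟨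
    lookup (restrict a q m · restrict a q n) v                ∎
    where
    open ≡-Reasoning
    lemma : ∀ v b → (if b then lookup (m · n) v else 0) ≡ (if b then lookup m v else 0) + (if b then lookup n v else 0)
    lemma v true = lookup-· m n v
    lemma v false = refl

  restrict-within : (m : Mono N) → Within a q m → restrict a q m ≡ m
  restrict-within m w = mono-ext λ v → trans (lookup-restrict m v) (lemma v (in? a q (toℕ v)))
    where
    lemma : ∀ v (d : Dec (In a q (toℕ v))) → (if does d then lookup m v else 0) ≡ lookup m v
    lemma v (yes _) = refl
    lemma v (no ¬p) = sym (decidable-stable (lookup m v ℕ.≟ 0) (λ ne → ¬p (w v ne)))

  restrict-outside : (m : Mono N) → (∀ v → lookup m v ≢ 0 → ¬ In a q (toℕ v)) → restrict a q m ≡ 𝟏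
  restrict-outside m w = mono-ext λ v → trans (lookup-restrict m v) (trans (lemma v (in? a q (toℕ v))) (sym (lookup-𝟏 v)))
    where
    lemma : ∀ v (d : Dec (In a q (toℕ v))) → (if does d then lookup m v else 0) ≡ 0
    lemma v (yes p) = decidable-stable (lookup m v ℕ.≟ 0) (λ ne → w v ne p)
    lemma v (no _) = refl

  restrict-𝟏 : restrict a q 𝟏 ≡ 𝟏
  restrict-𝟏 = restrict-outside 𝟏 λ v ne → ⊥-elim (ne (lookup-𝟏 v))

  within-·ˡ : (m n : Mono N) → Within a q (m · n) → Within a q m
  within-·ˡ m n w v ne = w v (occurs-·ˡ m n ne)

  within-·ʳ : (m n : Mono N) → Within a q (m · n) → Within a q n
  within-·ʳ m n w v ne = w v (occurs-·ʳ m n ne)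

  within-· : (m n : Mono N) → Within a q m → Within a q n → Within a q (m · n)
  within-· m n wm wn v ne = [ wm v , wn v ]′ (occurs-·⁻ m n ne)

  within-𝟏 : Within a q (𝟏 {N})
  within-𝟏 v ne = ⊥-elim (ne (lookup-𝟏 v))

  within-prod : (B : ℕ → List (Mono N)) (js : List ℕ) → (∀ {j m} → j ∈ js → m ∈ B j → Within a q m) →
                ∀ {m} → m ∈ prod (map B js) → Within a q m
  within-prod B [] wB (here refl) = within-𝟏
  within-prod B (j ∷ js) wB m∈ with ∈-cartesianProductWith⁻ _·_ (B j) (prod (map B js)) m∈
  ... | x , y , x∈ , y∈ , refl =
    within-· x y (wB (here refl) x∈) (within-prod B js (λ i∈ → wB (there i∈)) y∈)

-- Sizes of products, and products of factors on disjoint blocks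

length-⊙ : ∀ {N} (xs ys : List (Mono N)) → length (xs ⊙ ys) ≡ length xs * length ys
length-⊙ [] ys = refl
length-⊙ (x ∷ xs) ys = trans (ListP.length-++ (map (x ·_) ys)) (cong₂ _+_ (ListP.length-map (x ·_) ys) (length-⊙ xs ys))

-- It suffices to recover the left factor from a product; the right one then follows by
-- cancellation.
⊙-unique : ∀ {N} {xs ys : List (Mono N)} →
           (∀ {x x′ y y′} → x ∈ xs → x′ ∈ xs → y ∈ ys → y′ ∈ ys → x · y ≡ x′ · y′ → x ≡ x′) →
           Unique xs → Unique ys → Unique (xs ⊙ ys)
⊙-unique inj [] ys! = []
⊙-unique {xs = x ∷ xs} {ys} inj (x∉xs ∷ xs!) ys! = UniqueP.++⁺
  (UniqueP.map⁺ (·-cancelˡ x) ys!)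
  (⊙-unique (λ x∈ x′∈ → inj (there x∈) (there x′∈)) xs! ys!)
  disj
  where
  disj : Disjoint (map (x ·_) ys) (xs ⊙ ys)
  disj (z∈₁ , z∈₂) with ∈-map⁻ (x ·_) z∈₁ | ∈-cartesianProductWith⁻ _·_ xs ys z∈₂
  ... | y , y∈ , refl | x′ , y′ , x′∈ , y′∈ , eq =
    All.lookup x∉xs x′∈ (inj (here refl) (there x′∈) y∈ y′∈ eq)

map-⊙ : ∀ {N} (f : Mono N → Mono N) → (∀ m n → f (m · n) ≡ f m · f n) →
        ∀ xs ys → map f (xs ⊙ ys) ≡ map f xs ⊙ map f ys
map-⊙ f hom [] ys = refl
map-⊙ f hom (x ∷ xs) ys = trans (ListP.map-++ f (map (x ·_) ys) (xs ⊙ ys))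
  (cong₂ _++_ (trans (sym (ListP.map-∘ ys)) (trans (ListP.map-cong (hom x) ys) (ListP.map-∘ ys)))
              (map-⊙ f hom xs ys))

module Blocks {N} (B : ℕ → List (Mono N)) (a : ℕ → ℕ) (q : ℕ)
  (disjoint : ∀ {i j v} → In (a i) q v → In (a j) q v → i ≡ j)
  where

  Located : List ℕ → Set
  Located js = ∀ {j m} → j ∈ js → m ∈ B j → Within (a j) q m

  restrict-other : ∀ {i j} (m : Mono N) → i ≢ j → Within (a i) q m → restrict (a j) q m ≡ 𝟏
  restrict-other {i} {j} m i≢j w = restrict-outside (a j) q m λ v ne p → i≢j (disjoint (w v ne) p)

  restrict-prod-∉ : ∀ {j} js → Located js → j ∉ js → ∀ {m} → m ∈ prod (map B js) → restrict (a j) q m ≡ 𝟏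
  restrict-prod-∉ {j} [] loc j∉ (here refl) = restrict-𝟏 (a j) q
  restrict-prod-∉ {j} (i ∷ js) loc j∉ m∈ with ∈-cartesianProductWith⁻ _·_ (B i) (prod (map B js)) m∈
  ... | x , y , x∈ , y∈ , refl = begin
    restrict (a j) q (x · y)                  ≡⟨ restrict-· (a j) q x y ⟩
    restrict (a j) q x · restrict (a j) q y   ≡⟨ cong₂ _·_
      (restrict-other x (λ i≡j → j∉ (here (sym i≡j))) (loc (here refl) x∈))
      (restrict-prod-∉ js (λ i∈ → loc (there i∈)) (j∉ ∘ there) y∈) ⟩
    𝟏 · 𝟏                                     ≡⟨ ·-identityˡ 𝟏 ⟩
    𝟏                                         ∎
    where open ≡-Reasoning

  -- All the other factors live on blocks disjoint from block `i` and restrict to `𝟏`.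
  restrict-factorˡ : ∀ {i js x y} → Located (i ∷ js) → i ∉ js → x ∈ B i → y ∈ prod (map B js) →
                     restrict (a i) q (x · y) ≡ x
  restrict-factorˡ {i} {js} {x} {y} loc i∉ x∈ y∈ = begin
    restrict (a i) q (x · y)                  ≡⟨ restrict-· (a i) q x y ⟩
    restrict (a i) q x · restrict (a i) q y   ≡⟨ cong₂ _·_ (restrict-within (a i) q x (loc (here refl) x∈))
                                                           (restrict-prod-∉ js (λ i∈ → loc (there i∈)) i∉ y∈) ⟩
    x · 𝟏                                     ≡⟨ ·-identityʳ x ⟩
    x                                         ∎
    where open ≡-Reasoning

  restrict-factorʳ : ∀ {i j js x y} → Located (i ∷ js) → i ≢ j → x ∈ B i →
                     restrict (a j) q (x · y) ≡ restrict (a j) q y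
  restrict-factorʳ {i} {j} {js} {x} {y} loc i≢j x∈ = begin
    restrict (a j) q (x · y)                  ≡⟨ restrict-· (a j) q x y ⟩
    restrict (a j) q x · restrict (a j) q y   ≡⟨ cong (_· _) (restrict-other x i≢j (loc (here refl) x∈)) ⟩
    𝟏 · restrict (a j) q y                    ≡⟨ ·-identityˡ _ ⟩
    restrict (a j) q y                        ∎
    where open ≡-Reasoning

  restrict-prod-∈ : ∀ {j} js → Located js → Unique js → j ∈ js → ∀ {m} → m ∈ prod (map B js) → restrict (a j) q m ∈ B j
  restrict-prod-∈ (i ∷ js) loc (i∉ ∷ js!) j∈ m∈ with ∈-cartesianProductWith⁻ _·_ (B i) (prod (map B js)) m∈
  restrict-prod-∈ (i ∷ js) loc (i∉ ∷ js!) (here refl) m∈ | x , y , x∈ , y∈ , refl =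
    subst (_∈ B i) (sym (restrict-factorˡ loc (λ i∈ → All.lookup i∉ i∈ refl) x∈ y∈)) x∈
  restrict-prod-∈ {j} (i ∷ js) loc (i∉ ∷ js!) (there j∈) m∈ | x , y , x∈ , y∈ , refl =
    subst (_∈ B j) (sym (restrict-factorʳ {js = js} loc (All.lookup i∉ j∈) x∈))
      (restrict-prod-∈ js (λ i∈ → loc (there i∈)) js! j∈ y∈)

  -- A monomial of the full product is the product of its restrictions to the blocks, so membership
  -- in a smaller product can be tested block by block.
  ∈-prod : (D : ℕ → List (Mono N)) → ∀ js → Located js → Unique js → ∀ {m} → m ∈ prod (map B js) →
           (∀ {j} → j ∈ js → restrict (a j) q m ∈ D j) → m ∈ prod (map D js)
  ∈-prod D [] loc js! m∈ _ = m∈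
  ∈-prod D (i ∷ js) loc (i∉ ∷ js!) m∈ D∋ with ∈-cartesianProductWith⁻ _·_ (B i) (prod (map B js)) m∈
  ... | x , y , x∈ , y∈ , refl = ∈-cartesianProductWith⁺ _·_
    (subst (_∈ D i) (restrict-factorˡ loc (λ i∈ → All.lookup i∉ i∈ refl) x∈ y∈) (D∋ (here refl)))
    (∈-prod D js (λ i∈ → loc (there i∈)) js! y∈
      (λ {j} j∈ → subst (_∈ D j) (restrict-factorʳ {js = js} loc (All.lookup i∉ j∈) x∈) (D∋ (there j∈))))

  prod-unique : ∀ js → Located js → (∀ j → j ∈ js → Unique (B j)) → Unique js → Unique (prod (map B js))
  prod-unique [] loc B! js! = [] ∷ []
  prod-unique (i ∷ js) loc B! (i∉ ∷ js!) = ⊙-unique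
    (λ x∈ x′∈ y∈ y′∈ eq → trans (sym (restrict-factorˡ loc i∉js x∈ y∈))
      (trans (cong (restrict (a i) q) eq) (restrict-factorˡ loc i∉js x′∈ y′∈)))
    (B! i (here refl))
    (prod-unique js (λ i∈ → loc (there i∈)) (λ j j∈ → B! j (there j∈)) js!)
    where
    i∉js : i ∉ js
    i∉js i∈ = All.lookup i∉ i∈ refl

length-prod : ∀ {N} (B : ℕ → List (Mono N)) {c} js → (∀ {j} → j ∈ js → length (B j) ≡ c) →
              length (prod (map B js)) ≡ c ^ length js
length-prod B [] eq = refl
length-prod B (j ∷ js) eq =
  trans (length-⊙ (B j) _) (cong₂ _*_ (eq (here refl)) (length-prod B js (eq ∘ there)))

-- Densities of independent factors multiply. This turns density 1/2 on each factor into the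
-- exponential loss `2 ^ ℓ` on a term.
length-prod-half : ∀ {N} (D : ℕ → List (Mono N)) {c} js → (∀ {j} → j ∈ js → 2 * length (D j) ≤ c) →
                   2 ^ length js * length (prod (map D js)) ≤ c ^ length js
length-prod-half D [] le = ≤-refl
length-prod-half D {c} (j ∷ js) le = begin
  2 * 2 ^ n * length (D j ⊙ R)      ≡⟨ cong (2 * 2 ^ n *_) (length-⊙ (D j) R) ⟩
  2 * 2 ^ n * (length (D j) * length R) ≡⟨ [m*n]*[o*p]≡[m*o]*[n*p] 2 (2 ^ n) (length (D j)) (length R) ⟩
  2 * length (D j) * (2 ^ n * length R) ≤⟨ *-mono-≤ (le (here refl)) (length-prod-half D js (le ∘ there)) ⟩
  c * c ^ n                         ∎
  where
  open ≤-Reasoning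
  n = length js
  R = prod (map D js)

-- The monomials of the iterated sum-product polynomials

varMono : ∀ {N} → ℕ → Mono N
varMono i = tabulate λ j → if toℕ j ≡ᵇ i then 1 else 0

mutual
  -- The monomials of P^ℓ_k on the block of variables starting at off, with
  -- P^ℓ_0 a single variable.
  mons : ∀ {N} → ℕ → ℕ → ℕ → List (Mono N)
  mons ℓ zero    off = [ varMono off ]
  mons ℓ (suc k) off = concat (map (term ℓ k off) (upTo ℓ))

  term : ∀ {N} → ℕ → ℕ → ℕ → ℕ → List (Mono N)
  term ℓ k off i = prod (map (λ j → mons ℓ k (off + (i * ℓ + j) * ℓ ^ (2 * k))) (upTo ℓ))

count : ℕ → ℕ → ℕ
count ℓ zero    = 1
count ℓ (suc k) = ℓ * count ℓ k ^ ℓ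

occurs-varMono : ∀ {N} i {v : Fin N} → lookup (varMono i) v ≢ 0 → toℕ v ≡ i
occurs-varMono i {v} ne = lemma (toℕ v ≡ᵇ i) refl (λ eq → ne (trans (VecP.lookup∘tabulate _ v) eq))
  where
  lemma : ∀ b → (toℕ v ≡ᵇ i) ≡ b → (if b then 1 else 0) ≢ 0 → toℕ v ≡ i
  lemma true eq _ = ≡ᵇ⇒≡ (toℕ v) i (subst T (sym eq) _)
  lemma false _ ne = contradiction refl ne

varMono-≢𝟏 : ∀ {N i} → i < N → varMono {N} i ≢ 𝟏
varMono-≢𝟏 {N} {i} i<N = occurs⇒≢𝟏 {v = v} λ eq → 1≢0 (trans (sym lookup≡1) eq)
  where
  v = Fin.fromℕ< i<N
  1≢0 : 1 ≢ 0
  1≢0 ()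
  lemma : ∀ b → T b → (if b then 1 else 0) ≡ 1
  lemma true _ = refl
  lookup≡1 : lookup (varMono i) v ≡ 1
  lookup≡1 = trans (VecP.lookup∘tabulate _ v) (lemma _ (≡⇒≡ᵇ (toℕ v) i (FinP.toℕ-fromℕ< i<N)))

square-suc : ∀ ℓ k → ℓ ^ (2 * suc k) ≡ ℓ * (ℓ * ℓ ^ (2 * k))
square-suc ℓ k = cong (λ e → ℓ * ℓ ^ e) (+-suc k (k + 0))

module _ {N : ℕ} (ℓ : ℕ) where

  subblock-index : ∀ {i j} → i < ℓ → j < ℓ → i * ℓ + j < ℓ * ℓ
  subblock-index {i} {j} i<ℓ j<ℓ = begin-strict
    i * ℓ + j <⟨ +-monoʳ-< (i * ℓ) j<ℓ ⟩
    i * ℓ + ℓ ≡⟨ +-comm (i * ℓ) ℓ ⟩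
    suc i * ℓ ≤⟨ *-monoˡ-≤ ℓ i<ℓ ⟩
    ℓ * ℓ     ∎
    where open ≤-Reasoning

  subblock-fits : ∀ k off {i j} → i < ℓ → j < ℓ → off + ℓ ^ (2 * suc k) ≤ N →
                  off + (i * ℓ + j) * ℓ ^ (2 * k) + ℓ ^ (2 * k) ≤ N
  subblock-fits k off i<ℓ j<ℓ fits = ≤-trans (block-≤ off (ℓ ^ (2 * k)) (subblock-index i<ℓ j<ℓ))
    (subst (λ x → off + x ≤ N) (trans (square-suc ℓ k) (sym (*-assoc ℓ ℓ _))) fits)

  mutual
    mons-within : ∀ k off {m : Mono N} → m ∈ mons ℓ k off → Within off (ℓ ^ (2 * k)) m
    mons-within zero off (here refl) v ne = ≤-reflexive (sym eq) , ≤-reflexive (trans (cong suc eq) (+-comm 1 off))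
      where eq = occurs-varMono off {v} ne
    mons-within (suc k) off m∈ v ne with ∈-concat-map⁻ (term ℓ k off) (upTo ℓ) m∈
    ... | i , i∈ , m∈i = subst (λ x → In off x (toℕ v)) (sym (square-suc ℓ k))
      (in-block off (ℓ * ℓ ^ (2 * k)) (∈-upTo⁻ i∈) (term-within k off i m∈i v ne))

    term-within : ∀ k off i {m : Mono N} → m ∈ term ℓ k off i → Within (off + i * (ℓ * ℓ ^ (2 * k))) (ℓ * ℓ ^ (2 * k)) m
    term-within k off i = within-prod _ _ _ (upTo ℓ) λ j∈ m∈ v ne →
      in-subblock off ℓ (ℓ ^ (2 * k)) {i} (∈-upTo⁻ j∈) (mons-within k _ m∈ v ne)

  length-mons : ∀ k off → length (mons {N} ℓ k off) ≡ count ℓ k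
  length-term : ∀ k off i → length (term {N} ℓ k off i) ≡ count ℓ k ^ ℓ

  length-mons zero off = refl
  length-mons (suc k) off = trans (length-concat-map (term ℓ k off) (upTo ℓ) (λ {i} _ → length-term k off i))
    (cong (_* count ℓ k ^ ℓ) (ListP.length-upTo ℓ))

  length-term k off i = trans (length-prod _ (upTo ℓ) (λ _ → length-mons k _)) (cong (count ℓ k ^_) (ListP.length-upTo ℓ))

  module Term (k off i : ℕ) where
    q : ℕ
    q = ℓ ^ (2 * k)

    start : ℕ → ℕ
    start j = off + (i * ℓ + j) * q

    open Blocks {N} (λ j → mons ℓ k (start j)) start q
      (λ p p′ → +-cancelˡ-≡ (i * ℓ) _ _ (in-unique off q p p′))

    located : ∀ js → Located js
    located js _ m∈ = mons-within k _ m∈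

    restrict-term : ∀ {j m} → j < ℓ → m ∈ term ℓ k off i → restrict (start j) q m ∈ mons ℓ k (start j)
    restrict-term j<ℓ = restrict-prod-∈ (upTo ℓ) (located (upTo ℓ)) (UniqueP.upTo⁺ ℓ) (∈-upTo⁺ j<ℓ)

    ∈-term-prod : (D : ℕ → List (Mono N)) → ∀ {m} → m ∈ term ℓ k off i →
                  (∀ {j} → j < ℓ → restrict (start j) q m ∈ D j) → m ∈ prod (map D (upTo ℓ))
    ∈-term-prod D m∈ D∋ = ∈-prod D (upTo ℓ) (located (upTo ℓ)) (UniqueP.upTo⁺ ℓ) m∈ (D∋ ∘ ∈-upTo⁻)

    term-unique : (∀ j → j < ℓ → Unique (mons {N} ℓ k (start j))) → Unique (term {N} ℓ k off i)
    term-unique B! = prod-unique (upTo ℓ) (located (upTo ℓ)) (λ j j∈ → B! j (∈-upTo⁻ j∈)) (UniqueP.upTo⁺ ℓ)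

  module _ (0<ℓ : 0 < ℓ) where

    mons-≢𝟏 : ∀ k off → off + ℓ ^ (2 * k) ≤ N → ∀ {m : Mono N} → m ∈ mons ℓ k off → m ≢ 𝟏
    term-≢𝟏 : ∀ k off → off + ℓ ^ (2 * suc k) ≤ N → ∀ {i} → i < ℓ → ∀ {m : Mono N} → m ∈ term ℓ k off i → m ≢ 𝟏

    mons-≢𝟏 zero off fits (here refl) = varMono-≢𝟏 (≤-trans (≤-reflexive (+-comm 1 off)) fits)
    mons-≢𝟏 (suc k) off fits m∈ with ∈-concat-map⁻ (term ℓ k off) (upTo ℓ) m∈
    ... | i , i∈ , m∈i = term-≢𝟏 k off fits (∈-upTo⁻ i∈) m∈i

    -- If the product were `𝟏`, so would be its restriction to factor 0, which is a monomial one
    -- level down; `0<ℓ` guarantees that this factor exists.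
    term-≢𝟏 k off fits {i} i<ℓ m∈ refl =
      mons-≢𝟏 k _ (subblock-fits k off i<ℓ 0<ℓ fits) (restrict-term 0<ℓ m∈) (restrict-𝟏 (start 0) q)
      where open Term k off i

    -- Some variable occurs in `m`, and it lies in only one of the disjoint term blocks. Lying
    -- within the block of a term is what the descent below uses as the type of a monomial.
    term-type-unique : ∀ k off {m : Mono N} {i j} → m ≢ 𝟏 →
      Within (off + i * (ℓ * ℓ ^ (2 * k))) (ℓ * ℓ ^ (2 * k)) m →
      Within (off + j * (ℓ * ℓ ^ (2 * k))) (ℓ * ℓ ^ (2 * k)) m → i ≡ j
    term-type-unique k off m≢𝟏 wi wj with ≢𝟏⇒occurs m≢𝟏
    ... | v , ne = in-unique off (ℓ * ℓ ^ (2 * k)) (wi v ne) (wj v ne)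

    mons-unique : ∀ k off → off + ℓ ^ (2 * k) ≤ N → Unique (mons {N} ℓ k off)
    mons-unique zero off fits = [] ∷ []
    mons-unique (suc k) off fits = concat-map-unique (term ℓ k off)
      (λ {i} {j} i∈ _ x∈i x∈j → term-type-unique k off (term-≢𝟏 k off fits (∈-upTo⁻ i∈) x∈i)
                     (term-within k off i x∈i) (term-within k off j x∈j))
      terms! (UniqueP.upTo⁺ ℓ)
      where
      terms! : ∀ i → i ∈ upTo ℓ → Unique (term {N} ℓ k off i)
      terms! i i∈ = Term.term-unique k off i λ j j<ℓ → mons-unique k _ (subblock-fits k off (∈-upTo⁻ i∈) j<ℓ fits)

count>0 : ∀ {ℓ} → 0 < ℓ → ∀ k → 0 < count ℓ k
count>0 0<ℓ zero = s≤s z≤n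
count>0 {ℓ} 0<ℓ (suc k) = *-mono-≤ 0<ℓ (m^n>0 (count ℓ k) {{ℕ.>-nonZero (count>0 0<ℓ k)}} ℓ)

-- Supports of polynomials with nonnegative coefficients

-- The support of the formal list of terms, before like terms are collected. It turns `_⊕_` and
-- `_⊗_` into `_++_` and `_⊙_` on the nose, and for nonnegative coefficients it has the same members
-- as `_∈mon_`.
support : ∀ {N} → Poly N → List (Mono N)
support p = map proj₁ (List.filter (λ t → ¬? (proj₂ t ℚP.≟ 0ℚ)) p)

support-⊕ : ∀ {N} (p q : Poly N) → support (p ⊕ q) ≡ support p ++ support q
support-⊕ p q = trans (cong (map proj₁) (ListP.filter-++ _ p q)) (ListP.map-++ proj₁ (List.filter _ p) _)

*≢0 : ∀ {a b} → a ≢ 0ℚ → b ≢ 0ℚ → a ℚ.* b ≢ 0ℚ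
*≢0 {a} {b} a≢0 b≢0 ab≡0 = b≢0 (begin
  b                         ≡⟨ ℚP.*-identityˡ b ⟨
  1ℚ ℚ.* b                  ≡⟨ cong (ℚ._* b) (ℚP.*-inverseˡ a) ⟨
  ℚ.1/ a ℚ.* a ℚ.* b        ≡⟨ ℚP.*-assoc (ℚ.1/ a) a b ⟩
  ℚ.1/ a ℚ.* (a ℚ.* b)      ≡⟨ cong (ℚ.1/ a ℚ.*_) ab≡0 ⟩
  ℚ.1/ a ℚ.* 0ℚ             ≡⟨ ℚP.*-zeroʳ (ℚ.1/ a) ⟩
  0ℚ                        ∎)
  where
  open ≡-Reasoning
  instance _ = ℚ.≢-nonZero a≢0

support-scale : ∀ {N} (f : Mono N × ℚ → Mono N × ℚ) m a → (∀ n b → f (n , b) ≡ (m · n , a ℚ.* b)) →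
                a ≢ 0ℚ → ∀ q → support (map f q) ≡ map (m ·_) (support q)
support-scale f m a f≡ a≢0 [] = refl
support-scale f m a f≡ a≢0 ((n , b) ∷ q) rewrite f≡ n b with b ℚP.≟ 0ℚ | a ℚ.* b ℚP.≟ 0ℚ
... | yes b≡0 | yes _ = support-scale f m a f≡ a≢0 q
... | yes refl | no ab≢0 = contradiction (ℚP.*-zeroʳ a) ab≢0
... | no b≢0 | yes ab≡0 = contradiction ab≡0 (*≢0 a≢0 b≢0)
... | no _ | no _ = cong (m · n ∷_) (support-scale f m a f≡ a≢0 q)

support-scale-0 : ∀ {N} (f : Mono N × ℚ → Mono N × ℚ) m a → (∀ n b → f (n , b) ≡ (m · n , a ℚ.* b)) →
                  a ≡ 0ℚ → ∀ q → support (map f q) ≡ []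
support-scale-0 f m a f≡ a≡0 [] = refl
support-scale-0 f m a f≡ a≡0 ((n , b) ∷ q) rewrite f≡ n b with a ℚ.* b ℚP.≟ 0ℚ
... | yes _ = support-scale-0 f m a f≡ a≡0 q
... | no ab≢0 = contradiction (trans (cong (ℚ._* b) a≡0) (ℚP.*-zeroˡ b)) ab≢0

support-⊗ : ∀ {N} (p q : Poly N) → support (p ⊗ q) ≡ support p ⊙ support q
support-⊗ [] q = refl
support-⊗ ((m , a) ∷ p) q with a ℚP.≟ 0ℚ
... | yes a≡0 = trans (support-⊕ (map _ q) (p ⊗ q))
  (cong₂ _++_ (support-scale-0 _ m a (λ _ _ → refl) a≡0 q) (support-⊗ p q))
... | no a≢0 = trans (support-⊕ (map _ q) (p ⊗ q))
  (cong₂ _++_ (support-scale _ m a (λ _ _ → refl) a≢0 q) (support-⊗ p q))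

support-ΣP : ∀ {N} (f : ℕ → Poly N) {g} → (∀ i → support (f i) ≡ g i) →
             ∀ is → support (ΣP (map f is)) ≡ concat (map g is)
support-ΣP f eq [] = refl
support-ΣP f eq (i ∷ is) = trans (support-⊕ (f i) _) (cong₂ _++_ (eq i) (support-ΣP f eq is))

support-ΠP : ∀ {N} (f : ℕ → Poly N) {g} → (∀ i → support (f i) ≡ g i) →
             ∀ is → support (ΠP (map f is)) ≡ prod (map g is)
support-ΠP f eq [] = refl
support-ΠP f eq (i ∷ is) = trans (support-⊗ (f i) _) (cong₂ _⊙_ (eq i) (support-ΠP f eq is))

-- Stated from `suc k` on: at 0, `Ppoly` is the zero polynomial, while `mons` is a single variable
-- so that the first level is built like all others.
support-Ppoly : ∀ {N} ℓ k off → support (Ppoly {N} ℓ (suc k) off) ≡ mons ℓ (suc k) off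
support-Ppoly ℓ zero off = support-ΣP _ (λ i → support-ΠP _ (λ j → cong (λ x → [ varMono x ])
  (trans (+-assoc off (i * ℓ) j) (cong (off +_) (sym (*-identityʳ (i * ℓ + j)))))) (upTo ℓ)) (upTo ℓ)
support-Ppoly ℓ (suc k) off = support-ΣP _ (λ i → support-ΠP _ (λ j → support-Ppoly ℓ k _) (upTo ℓ)) (upTo ℓ)

NonNeg : ∀ {N} → Poly N → Set
NonNeg = All (λ t → 0ℚ ℚ.≤ proj₂ t)

*-nonNeg : ∀ {a b} → 0ℚ ℚ.≤ a → 0ℚ ℚ.≤ b → 0ℚ ℚ.≤ a ℚ.* b
*-nonNeg {a} {b} 0≤a 0≤b = ℚP.nonNegative⁻¹ _ {{ℚP.nonNeg*nonNeg⇒nonNeg a {{ℚ.nonNegative 0≤a}} b {{ℚ.nonNegative 0≤b}}}}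

nonNeg-⊗ : ∀ {N} {p q : Poly N} → NonNeg p → NonNeg q → NonNeg (p ⊗ q)
nonNeg-⊗ [] _ = []
nonNeg-⊗ (0≤a ∷ p≥0) q≥0 =
  AllP.++⁺ (AllP.map⁺ (All.map (*-nonNeg 0≤a) q≥0)) (nonNeg-⊗ p≥0 q≥0)

nonNeg-ΣP : ∀ {N} (f : ℕ → Poly N) → (∀ i → NonNeg (f i)) → ∀ is → NonNeg (ΣP (map f is))
nonNeg-ΣP f f≥0 [] = []
nonNeg-ΣP f f≥0 (i ∷ is) = AllP.++⁺ (f≥0 i) (nonNeg-ΣP f f≥0 is)

0≤1 : 0ℚ ℚ.≤ 1ℚ
0≤1 = ℚP.nonNegative⁻¹ 1ℚ

nonNeg-ΠP : ∀ {N} (f : ℕ → Poly N) → (∀ i → NonNeg (f i)) → ∀ is → NonNeg (ΠP (map f is))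
nonNeg-ΠP f f≥0 [] = 0≤1 ∷ []
nonNeg-ΠP f f≥0 (i ∷ is) = nonNeg-⊗ (f≥0 i) (nonNeg-ΠP f f≥0 is)

nonNeg-Ppoly : ∀ {N} ℓ k off → NonNeg (Ppoly {N} ℓ k off)
nonNeg-Ppoly ℓ zero off = []
nonNeg-Ppoly ℓ (suc zero) off = nonNeg-ΣP _ (λ i → nonNeg-ΠP _ (λ j → 0≤1 ∷ []) (upTo ℓ)) (upTo ℓ)
nonNeg-Ppoly ℓ (suc (suc k)) off = nonNeg-ΣP _ (λ i → nonNeg-ΠP _ (λ j → nonNeg-Ppoly ℓ (suc k) _) (upTo ℓ)) (upTo ℓ)

coeff-nonNeg : ∀ {N} {p : Poly N} → NonNeg p → ∀ m → 0ℚ ℚ.≤ coeff p m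
coeff-nonNeg [] m = ℚP.≤-refl
coeff-nonNeg {p = (n , a) ∷ p} (0≤a ∷ p≥0) m with n ≟m m
... | yes _ = ℚP.+-mono-≤ 0≤a (coeff-nonNeg p≥0 m)
... | no _ = coeff-nonNeg p≥0 m

+≢0ˡ : ∀ {a b} → 0ℚ ℚ.≤ a → 0ℚ ℚ.≤ b → a ≢ 0ℚ → a ℚ.+ b ≢ 0ℚ
+≢0ˡ {a} {b} 0≤a 0≤b a≢0 a+b≡0 = a≢0 (ℚP.≤-antisym (begin
  a         ≡⟨ ℚP.+-identityʳ a ⟨
  a ℚ.+ 0ℚ  ≤⟨ ℚP.+-monoʳ-≤ a 0≤b ⟩
  a ℚ.+ b   ≡⟨ a+b≡0 ⟩
  0ℚ        ∎) 0≤a)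
  where open ℚP.≤-Reasoning

-- Nonnegative terms cannot cancel: one positive summand keeps the collected coefficient away from
-- 0.
support⇒mon : ∀ {N} {p : Poly N} → NonNeg p → ∀ {m} → m ∈ support p → m ∈mon p
support⇒mon {p = (n , a) ∷ p} (0≤a ∷ p≥0) {m} m∈ with a ℚP.≟ 0ℚ | n ≟m m
... | yes refl | yes _ = λ eq → support⇒mon p≥0 m∈ (trans (sym (ℚP.+-identityˡ _)) eq)
... | yes _    | no _ = support⇒mon p≥0 m∈
... | no a≢0   | yes _ = +≢0ˡ 0≤a (coeff-nonNeg p≥0 m) a≢0
support⇒mon {p = (n , a) ∷ p} (0≤a ∷ p≥0) (here refl) | no _ | no n≢m = contradiction refl n≢m
support⇒mon {p = (n , a) ∷ p} (0≤a ∷ p≥0) (there m∈) | no _ | no _ = support⇒mon p≥0 m∈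

mon⇒support : ∀ {N} (p : Poly N) {m} → m ∈mon p → m ∈ support p
mon⇒support [] m∈ = contradiction refl m∈
mon⇒support ((n , a) ∷ p) {m} m∈ with n ≟m m | a ℚP.≟ 0ℚ
... | yes _    | yes refl = mon⇒support p (λ eq → m∈ (trans (ℚP.+-identityˡ _) eq))
... | yes refl | no _ = here refl
... | no _     | yes _ = mon⇒support p m∈
... | no _     | no _ = there (mon⇒support p m∈)

-- Circuits computing monomial sets

card : ∀ {N} → List (Mono N) → ℕ
card xs = length (deduplicate _≟m_ xs)

card-≤ : ∀ {N} {xs ys : List (Mono N)} → xs ⊆ ys → card xs ≤ length ys
card-≤ {xs = xs} sub = unique-⊆-length (UniqueDecP.deduplicate-! _≟m_ xs) (sub ∘ ∈-deduplicate⁻ _≟m_ xs)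

-- Gates of a circuit whose wires carry monomial sets.  A gate may be switched
-- off, its set then being ∅ or {𝟏}; only the live gates count towards the width.
data Node (m₁ p : ℕ) : Set where
  dead unit : Node m₁ p
  live      : Gate m₁ p → Node m₁ p

infixl 5 _▷_
-- The top layer is outermost, so what lies below a layer is again a tower and recursion runs from
-- the output downwards.
data Tower (m₁ : ℕ) : ℕ → Set where
  ∅   : Tower m₁ 0
  _▷_ : ∀ {p w} → Tower m₁ p → Vec (Node m₁ p) w → Tower m₁ w

liveness : ∀ {m₁ p} → Node m₁ p → ℕ
liveness (live _) = 1
liveness _        = 0

liveCount : ∀ {m₁ p w} → Vec (Node m₁ p) w → ℕ
liveCount []      = 0
liveCount (g ∷ L) = liveness g + liveCount L

Narrow : ∀ {m₁ w} → ℕ → Tower m₁ w → Set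
Narrow k ∅       = ⊤
Narrow k (t ▷ L) = Narrow k t × liveCount L ≤ k

gates : ∀ {m₁ w} → Tower m₁ w → ℕ
gates ∅               = 0
gates (_▷_ {w = w} t L) = gates t + w

childSet : ∀ {N m₁ p} → (Fin m₁ → List (Mono N)) → (Fin p → List (Mono N)) → Child m₁ p → List (Mono N)
childSet lv pv (leafC i) = lv i
childSet lv pv (prevC i) = pv i

opSet : ∀ {N} → Op → List (Mono N) → List (Mono N) → List (Mono N)
opSet plus  = _++_
opSet times = _⊙_

nodeSet : ∀ {N m₁ p} → (Fin m₁ → List (Mono N)) → (Fin p → List (Mono N)) → Node m₁ p → List (Mono N)
nodeSet lv pv dead               = []
nodeSet lv pv unit               = [ 𝟏 ]
nodeSet lv pv (live (gate o l r)) = opSet o (childSet lv pv l) (childSet lv pv r)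

set : ∀ {N m₁ w} → (Fin m₁ → List (Mono N)) → Tower m₁ w → Fin w → List (Mono N)
set lv (t ▷ L) h = nodeSet lv (set lv t) (lookup L h)

liveness≤liveCount : ∀ {m₁ p w} (L : Vec (Node m₁ p) w) h → liveness (lookup L h) ≤ liveCount L
liveness≤liveCount (g ∷ L) zero = m≤m+n _ _
liveness≤liveCount (g ∷ L) (suc h) = ≤-trans (liveness≤liveCount L h) (m≤n+m _ _)

liveCount-update : ∀ {m₁ p w} (L : Vec (Node m₁ p) w) h →
                   liveCount L ≡ liveness (lookup L h) + liveCount (L Vec.[ h ]≔ dead)
liveCount-update (g ∷ L) zero = refl
liveCount-update (g ∷ L) (suc h) = begin
  a + liveCount L       ≡⟨ cong (a +_) (liveCount-update L h) ⟩
  a + (b + c)           ≡⟨ +-assoc a b c ⟨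
  a + b + c             ≡⟨ cong (_+ c) (+-comm a b) ⟩
  b + a + c             ≡⟨ +-assoc b a c ⟩
  b + (a + c)           ∎
  where
  open ≡-Reasoning
  a = liveness g
  b = liveness (lookup L h)
  c = liveCount (L Vec.[ h ]≔ dead)

module _ {N m₁ : ℕ} where

  module _ (f : Mono N → Mono N) (f-· : ∀ m n → f (m · n) ≡ f m · f n) (f-𝟏 : f 𝟏 ≡ 𝟏)
           (lv : Fin m₁ → List (Mono N)) where

    opSet-map : ∀ o xs ys → opSet o (map f xs) (map f ys) ≡ map f (opSet o xs ys)
    opSet-map plus xs ys = sym (ListP.map-++ f xs ys)
    opSet-map times xs ys = sym (map-⊙ f f-· xs ys)

    -- Unions and Minkowski products commute with a homomorphism, so it can be pushed to the leaves.
    -- With `restrict` for `f`, the same tower computes the projection to one factor.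
    set-map : ∀ {w} (t : Tower m₁ w) h → set (map f ∘ lv) t h ≡ map f (set lv t h)
    childSet-map : ∀ {w} (t : Tower m₁ w) c →
                   childSet (map f ∘ lv) (set (map f ∘ lv) t) c ≡ map f (childSet lv (set lv t) c)

    childSet-map t (leafC i) = refl
    childSet-map t (prevC i) = set-map t i

    set-map (t ▷ L) h with lookup L h
    ... | dead = refl
    ... | unit = cong [_] (sym f-𝟏)
    ... | live (gate o l r) =
      trans (cong₂ (opSet o) (childSet-map t l) (childSet-map t r)) (opSet-map o _ _)

  module _ (lv : Fin m₁ → List (Mono N)) {p} {pv pv′ : Fin p → List (Mono N)} where

    nodeSet-mono : (∀ h → pv h ⊆ pv′ h) → ∀ g → nodeSet lv pv g ⊆ nodeSet lv pv′ g
    nodeSet-mono sub dead = id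
    nodeSet-mono sub unit = id
    nodeSet-mono sub (live (gate o l r)) = op o
      where
      child : ∀ c → childSet lv pv c ⊆ childSet lv pv′ c
      child (leafC i) = id
      child (prevC i) = sub i
      op : ∀ o → opSet o (childSet lv pv l) (childSet lv pv r) ⊆ opSet o (childSet lv pv′ l) (childSet lv pv′ r)
      op plus m∈ with ∈-++⁻ (childSet lv pv l) m∈
      ... | inj₁ m∈l = ∈-++⁺ˡ (child l m∈l)
      ... | inj₂ m∈r = ∈-++⁺ʳ (childSet lv pv′ l) (child r m∈r)
      op times m∈ with ∈-cartesianProductWith⁻ _·_ (childSet lv pv l) (childSet lv pv r) m∈
      ... | x , y , x∈ , y∈ , refl = ∈-cartesianProductWith⁺ _·_ (child l x∈) (child r y∈)

    -- A wire is only compared where it occurs, in a context c, below a gate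
    -- whose set is contained in T.
    nodeSet-context : (T : Mono N → Set) →
      (∀ h c → (∀ {m} → m ∈ pv h → T (c · m)) → pv h ⊆ pv′ h) →
      ∀ g c → (∀ {m} → m ∈ nodeSet lv pv g → T (c · m)) → nodeSet lv pv g ⊆ nodeSet lv pv′ g
    nodeSet-context T sub dead c ctx = id
    nodeSet-context T sub unit c ctx = id
    nodeSet-context T sub (live (gate o l r)) c = op o
      where
      child : ∀ d c → (∀ {m} → m ∈ childSet lv pv d → T (c · m)) → childSet lv pv d ⊆ childSet lv pv′ d
      child (leafC i) c ctx = id
      child (prevC i) c ctx = sub i c ctx
      op : ∀ o → (∀ {m} → m ∈ opSet o (childSet lv pv l) (childSet lv pv r) → T (c · m)) →
           opSet o (childSet lv pv l) (childSet lv pv r) ⊆ opSet o (childSet lv pv′ l) (childSet lv pv′ r)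
      op plus ctx m∈ with ∈-++⁻ (childSet lv pv l) m∈
      ... | inj₁ m∈l = ∈-++⁺ˡ (child l c (ctx ∘ ∈-++⁺ˡ) m∈l)
      ... | inj₂ m∈r = ∈-++⁺ʳ (childSet lv pv′ l) (child r c (ctx ∘ ∈-++⁺ʳ (childSet lv pv l)) m∈r)
      op times ctx m∈ with ∈-cartesianProductWith⁻ _·_ (childSet lv pv l) (childSet lv pv r) m∈
      ... | x , y , x∈ , y∈ , refl = ∈-cartesianProductWith⁺ _·_
        (child l (c · y) (λ {x′} x′∈ → subst T
          (trans (cong (c ·_) (·-comm x′ y)) (sym (·-assoc c y x′)))
          (ctx (∈-cartesianProductWith⁺ _·_ x′∈ y∈))) x∈)
        (child r (c · x) (λ {y′} y′∈ → subst T (sym (·-assoc c x y′))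
          (ctx (∈-cartesianProductWith⁺ _·_ x∈ y′∈))) y∈)

-- The inductive claim and its arithmetic

-- Powers of one variable are allowed. Leaf monomials are thin and stay so under restriction,
-- whereas for `2 ≤ ℓ` no monomial of a `term` is thin; so a descent never ends in a leaf.
Thin : ∀ {N} → Mono N → Set
Thin m = ∀ v w → lookup m v ≢ 0 → lookup m w ≢ 0 → v ≡ w

-- The form needed for induction: `off` varies because the factors of a term sit on different
-- blocks, and the leaf sets are arbitrary thin ones because the claim is applied to projections.
-- `Narrow` counts live gates only but `gates` counts all, so switching gates off lowers the width
-- and keeps the size.
LowerBound : ℕ → ℕ → Set
LowerBound ℓ k = ∀ {N m₁ w} off → off + ℓ ^ (2 * k) ≤ N →
  (lv : Fin m₁ → List (Mono N)) → (∀ i {m} → m ∈ lv i → Thin m) →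
  (t : Tower m₁ w) → Narrow k t → ∀ h → set lv t h ⊆ mons ℓ k off →
  count ℓ k ≤ 2 * card (set lv t h) → 2 ^ ℓ ≤ 2 * gates t

-- The union of the covers of the single gates of a layer; the weight `b` stays on the left to avoid
-- division.
finCover : ∀ {N b c} n {Q : Fin n → Mono N → Set} →
           (∀ h → Σ (List (Mono N)) λ W → b * length W ≤ c × (∀ {m} → Q h m → m ∈ W)) →
           Σ (List (Mono N)) λ W → b * length W ≤ n * c × (∀ h {m} → Q h m → m ∈ W)
finCover {b = b} zero cov = [] , ≤-reflexive (*-zeroʳ b) , λ ()
finCover {b = b} {c} (suc n) cov with cov zero | finCover {b = b} {c} n (cov ∘ suc)
... | W , W≤ , Q∈W | Ws , Ws≤ , Q∈Ws = W ++ Ws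
  , ≤-trans (≤-reflexive (trans (cong (b *_) (ListP.length-++ W)) (*-distribˡ-+ b (length W) (length Ws))))
            (+-mono-≤ W≤ Ws≤)
  , λ { zero q → ∈-++⁺ˡ (Q∈W q) ; (suc h) q → ∈-++⁺ʳ W (Q∈Ws h q) }

_∈?_ : ∀ {N} (m : Mono N) S → Dec (m ∈ S)
_∈?_ = DecMembership._∈?_ _≟m_

-- Here `b` terms of size `A` are given up and `V` monomials cover the rest. From
-- `ℓ * A ≤ 2 * V + 2 * K * A` and `2 * K < ℓ` one gets `A ≤ 2 * V`; multiplying by `E` and using
-- `E * V ≤ g * A` gives the claim after cancelling `A`.
excess-bound : ∀ {ℓ A E g K V b f} → 0 < A → ℓ * A ≤ 2 * f → f ≤ V + b * A → E * V ≤ g * A →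
               b ≤ K → 2 * K < ℓ → E ≤ 2 * g
excess-bound {ℓ} {A} {E} {g} {K} {V} {b} {f} 0<A ℓA≤2f f≤ EV≤ b≤K 2K<ℓ =
  +-cancelʳ-≤ (2 * K * E) E (2 * g) (*-cancelʳ-≤ _ _ A {{ℕ.>-nonZero 0<A}} (begin
    (E + 2 * K * E) * A           ≡⟨ lhs E K A ⟩
    E * (suc (2 * K) * A)         ≤⟨ *-monoʳ-≤ E (*-monoˡ-≤ A 2K<ℓ) ⟩
    E * (ℓ * A)                   ≤⟨ *-monoʳ-≤ E ℓA≤ ⟩
    E * (2 * (V + K * A))         ≡⟨ rhs E V K A ⟩
    2 * (E * V) + 2 * K * E * A   ≤⟨ +-monoˡ-≤ _ (*-monoʳ-≤ 2 EV≤) ⟩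
    2 * (g * A) + 2 * K * E * A   ≡⟨ collect g A K E ⟩
    (2 * g + 2 * K * E) * A       ∎))
  where
  open ≤-Reasoning
  ℓA≤ : ℓ * A ≤ 2 * (V + K * A)
  ℓA≤ = ≤-trans ℓA≤2f (*-monoʳ-≤ 2 (≤-trans f≤ (+-monoʳ-≤ V (*-monoˡ-≤ A b≤K))))
  lhs : ∀ E K A → (E + 2 * K * E) * A ≡ E * (suc (2 * K) * A)
  lhs = solve-∀
  rhs : ∀ E V K A → E * (2 * (V + K * A)) ≡ 2 * (E * V) + 2 * K * E * A
  rhs = solve-∀
  collect : ∀ g A K E → 2 * (g * A) + 2 * K * E * A ≡ (2 * g + 2 * K * E) * A
  collect = solve-∀

nonempty : ∀ {N} (S : List (Mono N)) → 0 < 2 * card S → Σ (Mono N) λ x → Σ (List (Mono N)) λ xs → S ≡ x ∷ xs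
nonempty (x ∷ xs) _ = x , xs , refl

-- Tracing monomials downwards and switching gates off

module Descent {N m₁ : ℕ} (ℓ : ℕ) (F : ℕ → List (Mono N)) (HasType : ℕ → Mono N → Set)
  (hasType? : ∀ τ m → Dec (HasType τ m))
  (type-·ˡ : ∀ τ x y → HasType τ (x · y) → HasType τ x)
  (type-·ʳ : ∀ τ x y → HasType τ (x · y) → HasType τ y)
  (type-· : ∀ τ x y → HasType τ x → HasType τ y → HasType τ (x · y))
  (type-unique : ∀ m {τ τ′} → m ≢ 𝟏 → HasType τ m → HasType τ′ m → τ ≡ τ′)
  (F-type : ∀ {τ m} → m ∈ F τ → HasType τ m)
  (F-≢𝟏 : ∀ {τ m} → τ < ℓ → m ∈ F τ → m ≢ 𝟏)
  (F-¬thin : ∀ {τ m} → τ < ℓ → m ∈ F τ → ¬ Thin m)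
  (lv : Fin m₁ → List (Mono N)) (thin : ∀ i {m} → m ∈ lv i → Thin m) where

  Mons : List (Mono N)
  Mons = concat (map F (upTo ℓ))

  ∈Mons⁻ : ∀ {m} → m ∈ Mons → Σ ℕ λ τ → τ < ℓ × m ∈ F τ
  ∈Mons⁻ m∈ with ∈-concat-map⁻ F (upTo ℓ) m∈
  ... | τ , τ∈ , m∈τ = τ , ∈-upTo⁻ τ∈ , m∈τ

  Mons-≢𝟏 : ∀ {m} → m ∈ Mons → m ≢ 𝟏
  Mons-≢𝟏 m∈ with ∈Mons⁻ m∈
  ... | τ , τ<ℓ , m∈τ = F-≢𝟏 τ<ℓ m∈τ

  Mons-¬thin : ∀ {m} → m ∈ Mons → ¬ Thin m
  Mons-¬thin m∈ with ∈Mons⁻ m∈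
  ... | τ , τ<ℓ , m∈τ = F-¬thin τ<ℓ m∈τ

  All𝟏 : List (Mono N) → Set
  All𝟏 S = ∀ {m} → m ∈ S → m ≡ 𝟏

  all𝟏? : ∀ S → All𝟏 S ⊎ Σ (Mono N) λ m → m ∈ S × m ≢ 𝟏
  all𝟏? S with Any.any? (λ m → ¬? (m ≟m 𝟏)) S
  ... | yes p = inj₂ (find p)
  ... | no ¬p = inj₁ λ {m} m∈ → decidable-stable (m ≟m 𝟏) λ m≢𝟏 → ¬p (Any.map (λ { refl → m≢𝟏 }) m∈)

  -- The type of `a` forces every `a · y` into the term of `a · b`, so all of `B` has that type; `b`
  -- does the same for `A`. Then every `x · y` has the type as well, and this determines its term.
  product-type : ∀ {A B} → (∀ {a b} → a ∈ A → b ∈ B → a · b ∈ Mons) →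
                 ∀ {a b} → a ∈ A → a ≢ 𝟏 → b ∈ B → b ≢ 𝟏 →
                 Σ ℕ λ τ → τ < ℓ × (∀ {x y} → x ∈ A → y ∈ B → x · y ∈ F τ)
  product-type {A} {B} sub {a} {b} a∈ a≢𝟏 b∈ b≢𝟏 = τ , ∈-upTo⁻ τ∈ , typed
    where
    split : ∀ {x y} → x ∈ A → y ∈ B → Σ ℕ λ σ → σ ∈ upTo ℓ × x · y ∈ F σ
    split x∈ y∈ = ∈-concat-map⁻ F (upTo ℓ) (sub x∈ y∈)
    τ = proj₁ (split a∈ b∈)
    τ∈ = proj₁ (proj₂ (split a∈ b∈))
    ab∈ = proj₂ (proj₂ (split a∈ b∈))
    typeˡ : ∀ {x y} σ → x · y ∈ F σ → HasType σ x
    typeˡ {x} {y} σ xy∈ = type-·ˡ σ x y (F-type {σ} xy∈)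
    typeʳ : ∀ {x y} σ → x · y ∈ F σ → HasType σ y
    typeʳ {x} {y} σ xy∈ = type-·ʳ σ x y (F-type {σ} xy∈)
    type-B : ∀ {y} → y ∈ B → HasType τ y
    type-B {y} y∈ with split a∈ y∈
    ... | σ , _ , ay∈ with type-unique a {τ} {σ} a≢𝟏 (typeˡ τ ab∈) (typeˡ σ ay∈)
    ... | refl = typeʳ τ ay∈
    type-A : ∀ {x} → x ∈ A → HasType τ x
    type-A {x} x∈ with split x∈ b∈
    ... | σ , _ , xb∈ with type-unique b {τ} {σ} b≢𝟏 (typeʳ τ ab∈) (typeʳ σ xb∈)
    ... | refl = typeˡ τ xb∈
    typed : ∀ {x y} → x ∈ A → y ∈ B → x · y ∈ F τ
    typed {x} {y} x∈ y∈ with split x∈ y∈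
    ... | σ , σ∈ , xy∈ with type-unique (x · y) {τ} {σ} (F-≢𝟏 {σ} (∈-upTo⁻ σ∈) xy∈)
                             (type-· τ x y (type-A x∈) (type-B y∈)) (F-type {σ} xy∈)
    ... | refl = xy∈

  -- The way of m down the circuit, through gates carrying m itself, to a gate
  -- all of whose monomials belong to a single term.
  data Trace : ∀ {w} → Tower m₁ w → Mono N → Set where
    stop : ∀ {w m} {t : Tower m₁ w} h τ → τ < ℓ → set lv t h ⊆ F τ → m ∈ set lv t h → Trace t m
    down : ∀ {p w m} {t : Tower m₁ p} {L : Vec (Node m₁ p) w} h → m ∈ set lv (t ▷ L) h → Trace t m → Trace (t ▷ L) m

  -- Counted from the top: the greatest depth is the lowest stopping layer.
  depth : ∀ {w m} {t : Tower m₁ w} → Trace t m → ℕ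
  depth (stop _ _ _ _ _) = 0
  depth (down _ _ tr) = suc (depth tr)

  -- At a sum `m` lies in one of the summands. At a product with one side all `𝟏` it lies in the
  -- other side. At a product of two nonconstant sets `product-type` allows `stop`. Leaves and
  -- constants cannot be reached, since members of `Mons` are neither thin nor `𝟏`.
  trace : ∀ {w} (t : Tower m₁ w) h {m} → set lv t h ⊆ Mons → m ∈ set lv t h → Trace t m
  trace-node : ∀ {p w} (t : Tower m₁ p) (L : Vec (Node m₁ p) w) h {m} → m ∈ set lv (t ▷ L) h →
               ∀ g → lookup L h ≡ g → nodeSet lv (set lv t) g ⊆ Mons → m ∈ nodeSet lv (set lv t) g → Trace (t ▷ L) m
  trace-child : ∀ {p w} (t : Tower m₁ p) (L : Vec (Node m₁ p) w) h {m} → m ∈ set lv (t ▷ L) h →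
                ∀ c → childSet lv (set lv t) c ⊆ Mons → m ∈ childSet lv (set lv t) c → Trace (t ▷ L) m

  trace-child t L h m∈h (leafC i) sub m∈ = contradiction (thin i m∈) (Mons-¬thin (sub m∈))
  trace-child t L h m∈h (prevC i) sub m∈ = down h m∈h (trace t i sub m∈)

  trace-node t L h m∈h dead eq sub ()
  trace-node t L h m∈h unit eq sub (here refl) = contradiction refl (Mons-≢𝟏 (sub (here refl)))
  trace-node t L h m∈h (live (gate plus l r)) eq sub m∈ with ∈-++⁻ (childSet lv (set lv t) l) m∈
  ... | inj₁ m∈l = trace-child t L h m∈h l (sub ∘ ∈-++⁺ˡ) m∈l
  ... | inj₂ m∈r = trace-child t L h m∈h r (sub ∘ ∈-++⁺ʳ (childSet lv (set lv t) l)) m∈r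
  trace-node t L h {m} m∈h (live (gate times l r)) eq sub m∈
    with ∈-cartesianProductWith⁻ _·_ (childSet lv (set lv t) l) (childSet lv (set lv t) r) m∈
  ... | a , b , a∈ , b∈ , refl
    with all𝟏? (childSet lv (set lv t) l) | all𝟏? (childSet lv (set lv t) r)
  ... | inj₁ l≡𝟏 | _ = trace-child t L h m∈h r
    (λ y∈ → subst (_∈ Mons) (absorb (l≡𝟏 a∈)) (sub (∈-cartesianProductWith⁺ _·_ a∈ y∈)))
    (subst (_∈ childSet lv (set lv t) r) (sym (absorb (l≡𝟏 a∈))) b∈)
    where
    absorb : ∀ {x y : Mono N} → x ≡ 𝟏 → x · y ≡ y
    absorb refl = ·-identityˡ _
  ... | inj₂ _ | inj₁ r≡𝟏 = trace-child t L h m∈h l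
    (λ x∈ → subst (_∈ Mons) (absorb (r≡𝟏 b∈)) (sub (∈-cartesianProductWith⁺ _·_ x∈ b∈)))
    (subst (_∈ childSet lv (set lv t) l) (sym (absorb (r≡𝟏 b∈))) a∈)
    where
    absorb : ∀ {x y : Mono N} → y ≡ 𝟏 → x · y ≡ x
    absorb refl = ·-identityʳ _
  ... | inj₂ (x , x∈ , x≢𝟏) | inj₂ (y , y∈ , y≢𝟏)
    with product-type (λ a∈ b∈ → sub (∈-cartesianProductWith⁺ _·_ a∈ b∈)) x∈ x≢𝟏 y∈ y≢𝟏
  ... | τ , τ<ℓ , typed = stop h τ τ<ℓ (subst (λ g → nodeSet lv (set lv t) g ⊆ F τ) (sym eq) sub-τ) m∈h
    where
    sub-τ : childSet lv (set lv t) l ⊙ childSet lv (set lv t) r ⊆ F τ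
    sub-τ z∈ with ∈-cartesianProductWith⁻ _·_ (childSet lv (set lv t) l) (childSet lv (set lv t) r) z∈
    ... | _ , _ , x∈ , y∈ , refl = typed x∈ y∈

  trace (t ▷ L) h sub m∈ = trace-node t L h m∈ (lookup L h) refl sub m∈

  -- One chosen nonconstant monomial decides: it has at most one type, and if `S` serves a term in
  -- some context, that term is its type. So each live gate accounts for at most one excluded term.
  types : List (Mono N) → List ℕ
  types S with all𝟏? S
  ... | inj₁ _ = []
  ... | inj₂ (m , _) with Any.any? (λ τ → hasType? τ m) (upTo ℓ)
  ... | yes p = [ proj₁ (find p) ]
  ... | no _ = []

  length-types : ∀ S → length (types S) ≤ 1
  length-types S with all𝟏? S
  ... | inj₁ _ = z≤n
  ... | inj₂ (m , _) with Any.any? (λ τ → hasType? τ m) (upTo ℓ)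
  ... | yes _ = ≤-refl
  ... | no _ = z≤n

  -- A nonconstant monomial of `S` inherits the type `τ` from its product with `c`, and by
  -- uniqueness `types S` would list `τ`.
  untyped : ∀ S {τ} c → τ < ℓ → τ ∉ types S → (∀ {m} → m ∈ S → c · m ∈ F τ) → All𝟏 S
  untyped S {τ} c τ<ℓ τ∉ ctx with all𝟏? S
  ... | inj₁ S≡𝟏 = S≡𝟏
  ... | inj₂ (m , m∈ , m≢𝟏) with Any.any? (λ τ → hasType? τ m) (upTo ℓ)
  ... | yes p = ⊥-elim (τ∉ (here (type-unique m m≢𝟏 (type-·ʳ τ c m (F-type (ctx m∈))) (proj₂ (proj₂ (find p))))))
  ... | no ¬p = ⊥-elim (¬p (Any.map (λ { refl → type-·ʳ τ c m (F-type (ctx m∈)) }) (∈-upTo⁺ τ<ℓ)))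

  layerTypes : ∀ {p w} → (Fin p → List (Mono N)) → Vec (Node m₁ p) w → List ℕ
  nodeTypes : ∀ {p} → (Fin p → List (Mono N)) → Node m₁ p → List ℕ

  nodeTypes pv (live g) = types (nodeSet lv pv (live g))
  nodeTypes pv _        = []

  layerTypes pv []      = []
  layerTypes pv (g ∷ L) = nodeTypes pv g ++ layerTypes pv L

  length-layerTypes : ∀ {p w} pv (L : Vec (Node m₁ p) w) → length (layerTypes pv L) ≤ liveCount L
  length-layerTypes pv [] = z≤n
  length-layerTypes pv (g ∷ L) = ≤-trans (≤-reflexive (ListP.length-++ (nodeTypes pv g)))
    (+-mono-≤ (length-nodeTypes g) (length-layerTypes pv L))
    where
    length-nodeTypes : ∀ g → length (nodeTypes pv g) ≤ liveness g
    length-nodeTypes dead = z≤n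
    length-nodeTypes unit = z≤n
    length-nodeTypes (live g) = length-types (nodeSet lv pv (live g))

  nodeTypes⊆layerTypes : ∀ {p w} pv (L : Vec (Node m₁ p) w) h → nodeTypes pv (lookup L h) ⊆ layerTypes pv L
  nodeTypes⊆layerTypes pv (g ∷ L) zero = ∈-++⁺ˡ
  nodeTypes⊆layerTypes pv (g ∷ L) (suc h) = ∈-++⁺ʳ (nodeTypes pv g) ∘ nodeTypes⊆layerTypes pv L h

  untyped-node : ∀ {p} pv (g : Node m₁ p) {τ} c → τ < ℓ → τ ∉ nodeTypes pv g →
                 (∀ {m} → m ∈ nodeSet lv pv g → c · m ∈ F τ) → All𝟏 (nodeSet lv pv g)
  untyped-node pv dead c τ<ℓ τ∉ ctx ()
  untyped-node pv unit c τ<ℓ τ∉ ctx (here refl) = refl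
  untyped-node pv (live g) c τ<ℓ τ∉ ctx = untyped (nodeSet lv pv (live g)) c τ<ℓ τ∉ ctx

  topTypes : ∀ {w} → Tower m₁ w → List ℕ
  topTypes ∅       = []
  topTypes (t ▷ L) = layerTypes (set lv t) L

  constant : ∀ {p} → Bool → Node m₁ p
  constant b = if b then unit else dead

  -- Keeps of each gate only whether its set contains `𝟏`, which is all that a gate without
  -- nonconstant monomials can supply.
  flatten : ∀ {w} → Tower m₁ w → Tower m₁ w
  flatten ∅       = ∅
  flatten (t ▷ L) = flatten t ▷ tabulate (λ h → constant (does (𝟏 ∈? set lv (t ▷ L) h)))

  -- A circuit for the terms outside excluded tr: the layer where tr stops only
  -- supplies constants to these terms, and above it the gate on the way of tr
  -- is useless for them.
  kill : ∀ {w m} {t : Tower m₁ w} → Trace t m → Tower m₁ w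
  kill {t = t} (stop _ _ _ _ _) = flatten t
  kill (down {L = L} h _ tr)    = kill tr ▷ (L Vec.[ h ]≔ dead)

  excluded : ∀ {w m} {t : Tower m₁ w} → Trace t m → List ℕ
  excluded {t = t} (stop _ τ _ _ _) = τ ∷ topTypes t
  excluded (down _ _ tr)            = excluded tr

  excluded-type : ∀ {w m} {t : Tower m₁ w} (tr : Trace t m) → Σ ℕ λ τ → τ ∈ excluded tr × τ < ℓ × m ∈ F τ
  excluded-type (stop h τ τ<ℓ sub m∈) = τ , here refl , τ<ℓ , sub m∈
  excluded-type (down h m∈ tr) = excluded-type tr

  trace-≢𝟏 : ∀ {w m} {t : Tower m₁ w} → Trace t m → m ≢ 𝟏
  trace-≢𝟏 tr with excluded-type tr
  ... | τ , _ , τ<ℓ , m∈ = F-≢𝟏 τ<ℓ m∈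

  -- One entry for the term of the stopping gate, and at most one for each live gate of its layer.
  length-excluded : ∀ {w m} {t : Tower m₁ w} (tr : Trace t m) {k} → Narrow k t → length (excluded tr) ≤ suc k
  length-excluded (stop {t = t ▷ L} h τ τ<ℓ sub m∈) (_ , L≤k) = s≤s (≤-trans (length-layerTypes (set lv t) L) L≤k)
  length-excluded (down h m∈ tr) (t≤k , _) = length-excluded tr t≤k

  gates-flatten : ∀ {w} (t : Tower m₁ w) → gates (flatten t) ≡ gates t
  gates-flatten ∅ = refl
  gates-flatten (_▷_ {w = w} t L) = cong (_+ w) (gates-flatten t)

  gates-kill : ∀ {w m} {t : Tower m₁ w} (tr : Trace t m) → gates (kill tr) ≡ gates t
  gates-kill {t = t} (stop h τ τ<ℓ sub m∈) = gates-flatten t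
  gates-kill (down {w = w} h m∈ tr) = cong (_+ w) (gates-kill tr)

  narrow-flatten : ∀ {w} k (t : Tower m₁ w) → Narrow k (flatten t)
  narrow-flatten k ∅ = tt
  narrow-flatten k (t ▷ L) = narrow-flatten k t , ≤-trans (≤-reflexive (no-live (λ h → does (𝟏 ∈? set lv (t ▷ L) h)))) z≤n
    where
    no-live : ∀ {w p} (b : Fin w → Bool) → liveCount {p = p} (tabulate (λ h → constant (b h))) ≡ 0
    no-live {zero} b = refl
    no-live {suc w} b with b zero
    ... | true = no-live (b ∘ suc)
    ... | false = no-live (b ∘ suc)

  -- Above the stop, the gate switched off in each layer was live: its set contains `m ≢ 𝟏`, which
  -- no dead or unit gate provides. From the stop downwards no live gate is left.
  narrow-kill : ∀ {w m} {t : Tower m₁ w} (tr : Trace t m) {k} → Narrow (suc k) t → Narrow k (kill tr)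
  narrow-kill {t = t} (stop h τ τ<ℓ sub m∈) nar = narrow-flatten _ t
  narrow-kill {m = m} (down {t = t} {L} h m∈ tr) {k} (nar , L≤) =
    narrow-kill tr nar , ≤-pred (≤-trans (≤-reflexive (sym one-less)) L≤)
    where
    is-live : ∀ g → m ∈ nodeSet lv (set lv t) g → liveness g ≡ 1
    is-live dead ()
    is-live unit (here m≡𝟏) = contradiction m≡𝟏 (trace-≢𝟏 tr)
    is-live (live _) _ = refl
    one-less : liveCount L ≡ suc (liveCount (L Vec.[ h ]≔ dead))
    one-less = trans (liveCount-update L h) (cong (_+ liveCount (L Vec.[ h ]≔ dead)) (is-live (lookup L h) m∈))

  set-flatten : ∀ {p w} (t : Tower m₁ p) (L : Vec (Node m₁ p) w) h →
                set lv (flatten (t ▷ L)) h ≡ (if does (𝟏 ∈? set lv (t ▷ L) h) then [ 𝟏 ] else [])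
  set-flatten t L h = trans
    (cong (nodeSet lv (set lv (flatten t))) (VecP.lookup∘tabulate (λ h → constant (does (𝟏 ∈? set lv (t ▷ L) h))) h))
    (lemma (does (𝟏 ∈? set lv (t ▷ L) h)))
    where
    lemma : ∀ b → nodeSet lv (set lv (flatten t)) (constant b) ≡ (if b then [ 𝟏 ] else [])
    lemma true = refl
    lemma false = refl

  flatten-⊆ : ∀ {w} (t : Tower m₁ w) h → set lv (flatten t) h ⊆ set lv t h
  flatten-⊆ (t ▷ L) h m∈ = lemma (𝟏 ∈? set lv (t ▷ L) h) (subst (_ ∈_) (set-flatten t L h) m∈)
    where
    lemma : ∀ {m} {S : List (Mono N)} (d : Dec (𝟏 ∈ S)) → m ∈ (if does d then [ 𝟏 ] else []) → m ∈ S
    lemma (yes 𝟏∈) (here refl) = 𝟏∈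
    lemma (no _) ()

  flatten-⊇ : ∀ {w} (t : Tower m₁ w) h → All𝟏 (set lv t h) → set lv t h ⊆ set lv (flatten t) h
  flatten-⊇ (t ▷ L) h S≡𝟏 m∈ = subst (_ ∈_) (sym (set-flatten t L h)) (lemma S≡𝟏 m∈ (𝟏 ∈? set lv (t ▷ L) h))
    where
    lemma : ∀ {m S} → All𝟏 S → m ∈ S → (d : Dec (𝟏 ∈ S)) → m ∈ (if does d then [ 𝟏 ] else [])
    lemma S≡𝟏 m∈ (yes _) = here (S≡𝟏 m∈)
    lemma S≡𝟏 m∈ (no 𝟏∉) = contradiction (subst (_∈ _) (S≡𝟏 m∈) m∈) 𝟏∉

  kill-⊆ : ∀ {w m} {t : Tower m₁ w} (tr : Trace t m) h → set lv (kill tr) h ⊆ set lv t h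
  kill-⊆ {t = t} (stop _ _ _ _ _) h = flatten-⊆ t h
  kill-⊆ (down {t = t} {L} h₀ m∈ tr) h x∈ with h Fin.≟ h₀
  ... | yes refl with subst (λ g → _ ∈ nodeSet lv (set lv (kill tr)) g) (VecP.lookup∘updateAt h L) x∈
  ... | ()
  kill-⊆ (down {t = t} {L} h₀ m∈ tr) h x∈ | no h≢h₀ =
    nodeSet-mono lv (kill-⊆ tr) (lookup L h)
      (subst (λ g → _ ∈ nodeSet lv (set lv (kill tr)) g) (VecP.lookup∘updateAt′ h h₀ h≢h₀ L) x∈)

  -- Through products only a part of a monomial passes along a wire, hence the context `c`. In the
  -- stopping layer a gate serving `τ` holds only `𝟏`, which `flatten` keeps. Higher up, the gate
  -- switched off contains `m`; serving `τ` would give `m` the type `τ`, but its only type is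
  -- excluded.
  kill-⊇ : ∀ {w m} {t : Tower m₁ w} (tr : Trace t m) {τ} → τ < ℓ → τ ∉ excluded tr →
           ∀ h c → (∀ {x} → x ∈ set lv t h → c · x ∈ F τ) → set lv t h ⊆ set lv (kill tr) h
  kill-⊇ (stop {t = t ▷ L} _ _ _ _ _) τ<ℓ τ∉ h c ctx = flatten-⊇ (t ▷ L) h
    (untyped-node (set lv t) (lookup L h) c τ<ℓ (τ∉ ∘ there ∘ nodeTypes⊆layerTypes (set lv t) L h) ctx)
  kill-⊇ {m = m} (down {t = t} {L} h₀ m∈ tr) {τ} τ<ℓ τ∉ h c ctx x∈ with h Fin.≟ h₀ | excluded-type tr
  ... | yes refl | τ₀ , τ₀∈ , τ₀<ℓ , m∈F = contradiction
    (subst (_∈ excluded tr) (type-unique m (trace-≢𝟏 tr) (F-type m∈F) (type-·ʳ τ c m (F-type (ctx m∈)))) τ₀∈) τ∉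
  ... | no h≢h₀ | _ = subst (λ g → _ ∈ nodeSet lv (set lv (kill tr)) g) (sym (VecP.lookup∘updateAt′ h h₀ h≢h₀ L))
    (nodeSet-context lv (_∈ F τ) (kill-⊇ tr τ<ℓ τ∉) (lookup L h) c ctx x∈)

  Covered : ∀ {w} → Tower m₁ w → Fin w → Mono N → Set
  Covered t h m = Σ ℕ λ τ → τ < ℓ × set lv t h ⊆ F τ × m ∈ set lv t h

  -- A monomial may have several traces, so the maximum is over chosen ones and the conclusion only
  -- asserts that a trace of bounded depth exists.
  deepest : ∀ {w} {t : Tower m₁ w} x xs → (∀ {y} → y ∈ x ∷ xs → Trace t y) →
            Σ (Mono N) λ m → Σ (Trace t m) λ tr → ∀ {y} → y ∈ x ∷ xs → Σ (Trace t y) λ tr′ → depth tr′ ≤ depth tr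
  deepest x [] tr = x , tr (here refl) , λ { (here refl) → tr (here refl) , ≤-refl }
  deepest x (x′ ∷ xs) tr with deepest x′ xs (tr ∘ there)
  ... | m , tr₀ , max with ≤-total (depth (tr (here refl))) (depth tr₀)
  ... | inj₁ le = m , tr₀ , λ { (here refl) → tr (here refl) , le ; (there y∈) → max y∈ }
  ... | inj₂ ge = x , tr (here refl) , λ { (here refl) → tr (here refl) , ≤-refl
                                         ; (there y∈) → let tr′ , le = max y∈ in tr′ , ≤-trans le ge }

  module _ {k s E A : ℕ}
    (nodeCover : ∀ {w} (t : Tower m₁ w) → Narrow k t → gates t ≤ s → ∀ h →
                 Σ (List (Mono N)) λ W → E * length W ≤ A × (∀ {m} → Covered t h m → m ∈ W)) where

    -- Recursion along `tr`, adding a cover for each layer above the stop. A monomial stopping at a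
    -- gate of such a layer is in an excluded term or is still computed there by `kill`, which is
    -- narrower by one and so falls under `nodeCover`.
    cover : ∀ {w m} {t : Tower m₁ w} (tr : Trace t m) → Narrow (suc k) t → gates t ≤ s →
            Σ (List (Mono N)) λ W → E * length W ≤ gates t * A ×
              (∀ {x} (tr′ : Trace t x) → depth tr′ ≤ depth tr → x ∈ W ⊎ Σ ℕ λ τ → τ ∈ excluded tr × x ∈ F τ)
    -- The empty cover suffices: in this layer a gate of a term that is not excluded would hold only
    -- `𝟏`.
    cover {t = t ▷ L} tr@(stop _ _ _ _ _) nar t≤s = [] , ≤-trans (≤-reflexive (*-zeroʳ E)) z≤n , covers
      where
      covers : ∀ {x} (tr′ : Trace (t ▷ L) x) → depth tr′ ≤ 0 → x ∈ [] ⊎ Σ ℕ λ τ → τ ∈ excluded tr × x ∈ F τ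
      covers {x} (stop h τ τ<ℓ sub x∈) _ with τ ∈ℕ? excluded tr
      ... | yes τ∈ = inj₂ (τ , τ∈ , sub x∈)
      ... | no τ∉ = contradiction
        (untyped-node (set lv t) (lookup L h) 𝟏 τ<ℓ (τ∉ ∘ there ∘ nodeTypes⊆layerTypes (set lv t) L h)
          (λ {y} y∈ → subst (_∈ F τ) (sym (·-identityˡ y)) (sub y∈)) x∈)
        (F-≢𝟏 τ<ℓ (sub x∈))
    cover tr@(down {w = w} {t = t} {L} h₀ m∈ tr₀) nar t≤s
      with cover tr₀ (proj₁ nar) (≤-trans (m≤m+n (gates t) w) t≤s)
         | finCover {b = E} {A} w {Covered (kill tr)}
             (nodeCover (kill tr) (narrow-kill tr nar) (≤-trans (≤-reflexive (gates-kill tr)) t≤s))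
    ... | W , W≤ , W∋ | V , V≤ , V∋ = W ++ V , bound , covers
      where
      open ≤-Reasoning
      bound : E * length (W ++ V) ≤ (gates t + w) * A
      bound = begin
        E * length (W ++ V)           ≡⟨ cong (E *_) (ListP.length-++ W) ⟩
        E * (length W + length V)     ≡⟨ *-distribˡ-+ E (length W) (length V) ⟩
        E * length W + E * length V   ≤⟨ +-mono-≤ W≤ V≤ ⟩
        gates t * A + w * A           ≡⟨ *-distribʳ-+ A (gates t) w ⟨
        (gates t + w) * A             ∎
      covers : ∀ {x} (tr′ : Trace (t ▷ L) x) → depth tr′ ≤ suc (depth tr₀) →
               x ∈ W ++ V ⊎ Σ ℕ λ τ → τ ∈ excluded tr × x ∈ F τ
      covers (down h x∈ tr′) (s≤s d≤) with W∋ tr′ d≤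
      ... | inj₁ x∈W = inj₁ (∈-++⁺ˡ x∈W)
      ... | inj₂ p = inj₂ p
      covers {x} (stop h τ τ<ℓ sub x∈) _ with τ ∈ℕ? excluded tr
      ... | yes τ∈ = inj₂ (τ , τ∈ , sub x∈)
      -- With context `𝟏`, `kill-⊇` keeps `x` at this gate, and `kill-⊆` keeps the set of the gate
      -- inside term `τ`.
      ... | no τ∉ = inj₁ (∈-++⁺ʳ W (V∋ h (τ , τ<ℓ , sub ∘ kill-⊆ tr h ,
        kill-⊇ tr τ<ℓ τ∉ h 𝟏 (λ {y} y∈ → subst (_∈ F τ) (sym (·-identityˡ y)) (sub y∈)) x∈)))

    -- Comparing all monomials of the output with a deepest trace makes `cover` apply to each of
    -- them: those outside its list fill at most `k + 2` terms of size `A`.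
    dense-bound : (∀ τ → length (F τ) ≡ A) → 0 < A → 2 * suc (suc k) < ℓ →
                  ∀ {w} (t : Tower m₁ w) → Narrow (suc k) t → gates t ≤ s → ∀ h → set lv t h ⊆ Mons →
                  ℓ * A ≤ 2 * card (set lv t h) → E ≤ 2 * gates t
    dense-bound length-F 0<A large t nar t≤s h sub dense
      with nonempty (set lv t h) (≤-trans (*-mono-≤ (≤-trans (s≤s z≤n) large) 0<A) dense)
    ... | x , xs , S≡ with deepest x xs (λ y∈ → trace t h sub (subst (_ ∈_) (sym S≡) y∈))
    ... | m , tr , max with cover tr nar t≤s
    ... | W , W≤ , W∋ = excess-bound {g = gates t} 0<A dense card≤ W≤ (length-excluded tr nar) large
      where
      covered : set lv t h ⊆ W ++ concat (map F (excluded tr))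
      covered y∈ with max (subst (_ ∈_) S≡ y∈)
      ... | tr′ , le with W∋ tr′ le
      ... | inj₁ y∈W = ∈-++⁺ˡ y∈W
      ... | inj₂ (τ , τ∈ , y∈τ) = ∈-++⁺ʳ W (∈-concat-map⁺ F τ∈ y∈τ)
      card≤ : card (set lv t h) ≤ length W + length (excluded tr) * A
      card≤ = ≤-trans (card-≤ covered) (≤-reflexive (trans (ListP.length-++ W)
        (cong (length W +_) (length-concat-map F (excluded tr) (λ {τ} _ → length-F τ)))))

-- Induction on the width

-- Factors 0 and 1 each contribute a variable, and their blocks are disjoint.
term-¬thin : ∀ {N} ℓ k off {τ} → 2 ≤ ℓ → off + ℓ ^ (2 * suc k) ≤ N → τ < ℓ →
                 ∀ {m : Mono N} → m ∈ term ℓ k off τ → ¬ Thin m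
term-¬thin {N} ℓ k off {τ} 2≤ℓ fits τ<ℓ {m} m∈ m-thin
  with in-factor 0<ℓ | in-factor 2≤ℓ
  where
  open Term {N} ℓ k off τ using (q; start; restrict-term)
  0<ℓ : 0 < ℓ
  0<ℓ = ≤-trans (s≤s z≤n) 2≤ℓ
  in-factor : ∀ {j} → j < ℓ → Σ (Fin N) λ v → lookup m v ≢ 0 × In (start j) q (toℕ v)
  in-factor {j} j<ℓ with restrict-term j<ℓ m∈
  ... | r∈ with ≢𝟏⇒occurs (mons-≢𝟏 ℓ 0<ℓ k (start j) (subblock-fits ℓ k off τ<ℓ j<ℓ fits) r∈)
  ... | v , ne = v , occurs-restrict (start j) q {m = m} ne , mons-within ℓ k (start j) r∈ v ne
... | v , v-occurs , v-in | w , w-occurs , w-in with m-thin v w v-occurs w-occurs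
... | refl with +-cancelˡ-≡ (τ * ℓ) 0 1 (in-unique off (ℓ ^ (2 * k)) v-in w-in)
... | ()

module Induction (ℓ k : ℕ) (large : 2 * suc (suc k) < ℓ) (lower : LowerBound ℓ k)
  {N m₁ : ℕ} (off : ℕ) (fits : off + ℓ ^ (2 * suc k) ≤ N)
  (lv : Fin m₁ → List (Mono N)) (thin : ∀ i {m} → m ∈ lv i → Thin m) where

  2≤ℓ : 2 ≤ ℓ
  2≤ℓ = ≤-trans (≤-trans (s≤s (s≤s z≤n)) (m≤m+n (suc (suc k)) _)) (<⇒≤ large)

  0<ℓ : 0 < ℓ
  0<ℓ = ≤-trans (s≤s z≤n) 2≤ℓ

  q : ℕ
  q = ℓ ^ (2 * k)

  open Descent ℓ (term ℓ k off) (λ τ → Within (off + τ * (ℓ * q)) (ℓ * q))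
    (λ τ → within? (off + τ * (ℓ * q)) (ℓ * q))
    (λ τ → within-·ˡ (off + τ * (ℓ * q)) (ℓ * q))
    (λ τ → within-·ʳ (off + τ * (ℓ * q)) (ℓ * q))
    (λ τ → within-· (off + τ * (ℓ * q)) (ℓ * q))
    (λ m → term-type-unique ℓ 0<ℓ k off)
    (λ {τ} → term-within ℓ k off τ)
    (λ τ<ℓ m∈ → term-≢𝟏 ℓ 0<ℓ k off fits τ<ℓ m∈)
    (λ τ<ℓ m∈ → term-¬thin ℓ k off 2≤ℓ fits τ<ℓ m∈)
    lv thin

  A : ℕ
  A = count ℓ k ^ ℓ

  -- If all projections of a subset of a term to its factors have density at
  -- most 1/2, then the subset has density at most 2^-ℓ.
  nodeCover : ∀ {s} → ¬ 2 ^ ℓ ≤ 2 * s → ∀ {w} (t : Tower m₁ w) → Narrow k t → gates t ≤ s → ∀ h →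
              Σ (List (Mono N)) λ W → 2 ^ ℓ * length W ≤ A × (∀ {m} → Covered t h m → m ∈ W)
  nodeCover {s} small t nar t≤s h
    -- The term is fixed before any monomial is given, so that one list serves them all. If the set
    -- fits into no term, nothing is `Covered`.
    with Any.any? (λ τ → All.all? (λ m → m ∈? term ℓ k off τ) (set lv t h)) (upTo ℓ)
  ... | no ¬p = [] , ≤-trans (≤-reflexive (*-zeroʳ (2 ^ ℓ))) z≤n ,
    λ (τ , τ<ℓ , sub , _) → contradiction (Any.map (λ { refl → All.tabulate sub }) (∈-upTo⁺ τ<ℓ)) ¬p
  ... | yes p with find p
  ... | τ , τ∈ , in-τ = prod (map D (upTo ℓ))
    , subst (λ n → 2 ^ n * length (prod (map D (upTo ℓ))) ≤ count ℓ k ^ n) (ListP.length-upTo ℓ)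
        (length-prod-half D (upTo ℓ) λ j∈ → D-half (∈-upTo⁻ j∈))
    , λ (_ , _ , _ , m∈) → ∈-term-prod D (All.lookup in-τ m∈) λ {j} _ →
        ∈-deduplicate⁺ _≟m_ (subst (_ ∈_) (sym (projected j)) (∈-map⁺ (π j) m∈))
    where
    open Term {N} ℓ k off τ using (start; restrict-term; ∈-term-prod)
    π : ℕ → Mono N → Mono N
    π j = restrict (start j) q
    D : ℕ → List (Mono N)
    D j = deduplicate _≟m_ (set (map (π j) ∘ lv) t h)
    projected : ∀ j → set (map (π j) ∘ lv) t h ≡ map (π j) (set lv t h)
    projected j = set-map (π j) (restrict-· (start j) q) (restrict-𝟏 (start j) q) lv t h
    π-thin : ∀ j i {m} → m ∈ map (π j) (lv i) → Thin m
    π-thin j i m∈ with ∈-map⁻ (π j) m∈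
    ... | m , m∈i , refl = λ v w v-occurs w-occurs →
      thin i m∈i v w (occurs-restrict (start j) q {m = m} v-occurs) (occurs-restrict (start j) q {m = m} w-occurs)
    π-sub : ∀ {j} → j < ℓ → set (map (π j) ∘ lv) t h ⊆ mons ℓ k (start j)
    π-sub {j} j<ℓ x∈ with ∈-map⁻ (π j) (subst (_ ∈_) (projected j) x∈)
    ... | m , m∈ , refl = restrict-term j<ℓ (All.lookup in-τ m∈)
    D-half : ∀ {j} → j < ℓ → 2 * length (D j) ≤ count ℓ k
    D-half {j} j<ℓ with ≤-total (2 * length (D j)) (count ℓ k)
    ... | inj₁ le = le
    -- A dense projection is computed by the same tower over restricted leaves, so `lower` would
    -- yield `2 ^ ℓ ≤ 2 * s`.
    ... | inj₂ ge = contradiction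
      (≤-trans (lower (start j) (subblock-fits ℓ k off (∈-upTo⁻ τ∈) j<ℓ fits) (map (π j) ∘ lv) (π-thin j)
                 t nar h (π-sub j<ℓ) ge)
               (*-monoʳ-≤ 2 t≤s))
      small

  bound : ∀ {w} (t : Tower m₁ w) → Narrow (suc k) t → ∀ h → set lv t h ⊆ mons ℓ (suc k) off →
          count ℓ (suc k) ≤ 2 * card (set lv t h) → 2 ^ ℓ ≤ 2 * gates t
  -- Assuming that the tower is small makes `nodeCover` available with `s = gates t`, and the
  -- resulting bound refutes the assumption.
  bound t nar h sub dense = decidable-stable (2 ^ ℓ ≤? 2 * gates t) λ small → small
    (dense-bound (nodeCover small) (length-term ℓ k off) (m^n>0 (count ℓ k) {{ℕ.>-nonZero (count>0 0<ℓ k)}} ℓ)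
      large t nar ≤-refl h sub dense)

lowerBound : ∀ ℓ k → 2 * suc k < ℓ → LowerBound ℓ k
-- Without live gates the set is `[]`, which is not dense, or `[ 𝟏 ]`, which is not contained in a
-- single variable.
lowerBound ℓ zero large off fits lv thin (t ▷ L) (_ , L≤0) h sub dense =
  no-node (lookup L h) (≤-trans (liveness≤liveCount L h) L≤0) sub dense
  where
  no-node : ∀ {p pv} (g : Node _ p) → liveness g ≤ 0 → nodeSet lv pv g ⊆ mons ℓ 0 off →
            1 ≤ 2 * card (nodeSet lv pv g) → 2 ^ ℓ ≤ 2 * gates (t ▷ L)
  no-node dead _ _ ()
  no-node unit _ sub _ = contradiction refl (mons-≢𝟏 ℓ (≤-trans (s≤s z≤n) large) 0 off fits (sub (here refl)))
  no-node (live _) () _ _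
lowerBound ℓ (suc k) large off fits lv thin =
  Induction.bound ℓ k large (lowerBound ℓ k (≤-trans (s≤s (*-monoʳ-≤ 2 (n≤1+n (suc k)))) large)) off fits lv thin

-- From layered circuits to towers

module _ {N m₁ : ℕ} (leafPolys : Vec (Poly N) m₁) where

  leafSets : Fin m₁ → List (Mono N)
  leafSets i = support (lookup leafPolys i)

  support-gate : ∀ {p} (pv : Vec (Poly N) p) (sv : Fin p → List (Mono N)) → (∀ h → sv h ≡ support (lookup pv h)) →
                 ∀ g → nodeSet leafSets sv (live g) ≡ support (gatePoly leafPolys pv g)
  support-gate pv sv eq (gate o l r) = trans (cong₂ (opSet o) (child l) (child r)) (sym (op o))
    where
    child : ∀ c → childSet leafSets sv c ≡ support (childPoly leafPolys pv c)
    child (leafC i) = refl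
    child (prevC i) = eq i
    op : ∀ o {p q} → support (opPoly o p q) ≡ opSet o (support p) (support q)
    op plus {p} {q} = support-⊕ p q
    op times {p} {q} = support-⊗ p q

  -- The layers read so far are accumulated in `t`, and the recursion stops at the layer of the
  -- selected gate, which becomes the top. All gates start live, so the width of the circuit gives
  -- `Narrow k`.
  tower : ∀ {p k} (t : Tower m₁ p) (pv : Vec (Poly N) p) → (∀ h → set leafSets t h ≡ support (lookup pv h)) →
          Narrow k t → ∀ L → layersWidth L ≤ k → ∀ o →
          Σ ℕ λ w → Σ (Tower m₁ w) λ t′ → Σ (Fin w) λ h →
            set leafSets t′ h ≡ support (lookup (evalLayers leafPolys pv L) o) ×
            Narrow k t′ × gates t′ ≤ gates t + layersSize L
  tower {k = k} t pv eq nar (_∷_ {w = w} layer L) width≤k o =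
    result (Fin.splitAt w o) (VecP.lookup-splitAt w cur (evalLayers leafPolys cur L) o)
    where
    cur = Vec.map (gatePoly leafPolys pv) layer
    t₁ = t ▷ Vec.map live layer
    live-all : ∀ {p w} (layer : Vec (Gate m₁ p) w) → liveCount (Vec.map live layer) ≡ w
    live-all [] = refl
    live-all (g ∷ layer) = cong suc (live-all layer)
    nar₁ : Narrow k t₁
    nar₁ = nar , ≤-trans (≤-reflexive (live-all layer)) (≤-trans (m≤m⊔n w (layersWidth L)) width≤k)
    eq₁ : ∀ h → set leafSets t₁ h ≡ support (lookup cur h)
    eq₁ h = begin
      nodeSet leafSets (set leafSets t) (lookup (Vec.map live layer) h)
        ≡⟨ cong (nodeSet leafSets (set leafSets t)) (VecP.lookup-map h live layer) ⟩
      nodeSet leafSets (set leafSets t) (live (lookup layer h))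
        ≡⟨ support-gate pv (set leafSets t) eq (lookup layer h) ⟩
      support (gatePoly leafPolys pv (lookup layer h))
        ≡⟨ cong support (VecP.lookup-map h (gatePoly leafPolys pv) layer) ⟨
      support (lookup cur h) ∎
      where open ≡-Reasoning
    result : ∀ {x} s → x ≡ [ lookup cur , lookup (evalLayers leafPolys cur L) ]′ s →
             Σ ℕ λ w′ → Σ (Tower m₁ w′) λ t′ → Σ (Fin w′) λ h →
               set leafSets t′ h ≡ support x × Narrow k t′ × gates t′ ≤ gates t + (w + layersSize L)
    result (inj₁ h) x≡ = w , t₁ , h , trans (eq₁ h) (cong support (sym x≡)) , nar₁ , +-monoʳ-≤ (gates t) (m≤m+n w _)
    result (inj₂ o′) x≡ with tower t₁ cur eq₁ nar₁ L (≤-trans (m≤n⊔m w (layersWidth L)) width≤k) o′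
    ... | w′ , t′ , h , eq′ , nar′ , size≤ = w′ , t′ , h , trans eq′ (cong support (sym x≡)) , nar′ ,
      ≤-trans size≤ (≤-reflexive (+-assoc (gates t) w _))

  nonNeg-gate : (∀ i → NonNeg (lookup leafPolys i)) → ∀ {p} (pv : Vec (Poly N) p) → (∀ h → NonNeg (lookup pv h)) →
                ∀ g → NonNeg (gatePoly leafPolys pv g)
  nonNeg-gate lv≥0 pv pv≥0 (gate o l r) = op o
    where
    child : ∀ c → NonNeg (childPoly leafPolys pv c)
    child (leafC i) = lv≥0 i
    child (prevC i) = pv≥0 i
    op : ∀ o → NonNeg (gatePoly leafPolys pv (gate o l r))
    op plus = AllP.++⁺ (child l) (child r)
    op times = nonNeg-⊗ (child l) (child r)

  nonNeg-layers : (∀ i → NonNeg (lookup leafPolys i)) → ∀ {p} (pv : Vec (Poly N) p) → (∀ h → NonNeg (lookup pv h)) →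
                  ∀ L o → NonNeg (lookup (evalLayers leafPolys pv L) o)
  nonNeg-layers lv≥0 pv pv≥0 (_∷_ {w = w} layer L) o =
    result (Fin.splitAt w o) (VecP.lookup-splitAt w cur (evalLayers leafPolys cur L) o)
    where
    cur = Vec.map (gatePoly leafPolys pv) layer
    cur≥0 : ∀ h → NonNeg (lookup cur h)
    cur≥0 h = subst NonNeg (sym (VecP.lookup-map h (gatePoly leafPolys pv) layer))
      (nonNeg-gate lv≥0 pv pv≥0 (lookup layer h))
    result : ∀ {x} s → x ≡ [ lookup cur , lookup (evalLayers leafPolys cur L) ]′ s → NonNeg x
    result (inj₁ h) refl = cur≥0 h
    result (inj₂ o′) refl = nonNeg-layers lv≥0 cur cur≥0 L o′

-- Counting monomials of polynomials, and the conclusion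

count≤numMon : ∀ {N} ℓ k off → 0 < ℓ → off + ℓ ^ (2 * suc k) ≤ N → count ℓ (suc k) ≤ numMon (Ppoly {N} ℓ (suc k) off)
count≤numMon {N} ℓ k off 0<ℓ fits = ≤-trans (≤-reflexive (sym (length-mons ℓ (suc k) off)))
  (unique-⊆-length (mons-unique ℓ 0<ℓ (suc k) off fits) listed)
  where
  P′ = Ppoly {N} ℓ (suc k) off
  support-listed : ∀ p → support {N} p ⊆ map proj₁ p
  support-listed p m∈ with ∈-map⁻ proj₁ m∈
  ... | t , t∈ , refl = ∈-map⁺ proj₁ (proj₁ (∈-filter⁻ (λ t → ¬? (proj₂ t ℚP.≟ 0ℚ)) t∈))
  listed : mons ℓ (suc k) off ⊆ monList P′
  listed m∈ with subst (_ ∈_) (sym (support-Ppoly ℓ k off)) m∈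
  ... | m∈P = ∈-deduplicate⁺ _≟m_ (∈-filter⁺ (λ m → ¬? (coeff P′ m ℚP.≟ 0ℚ)) (support-listed P′ m∈P)
                (support⇒mon (nonNeg-Ppoly ℓ (suc k) off) m∈P))

numMon≤card : ∀ {N} (p : Poly N) → numMon p ≤ card (support p)
numMon≤card p = unique-⊆-length (UniqueDecP.deduplicate-! _≟m_ _) λ m∈ →
  ∈-deduplicate⁺ _≟m_ (mon⇒support p (proj₂ (∈-filter⁻ (λ m → ¬? (coeff p m ℚP.≟ 0ℚ)) {xs = map proj₁ p}
    (∈-deduplicate⁻ _≟m_ (List.filter (λ m → ¬? (coeff p m ℚP.≟ 0ℚ)) (map proj₁ p)) m∈))))

leaf-thin : ∀ {N} (x : Leaf N) {m} → m ∈ support (leafPoly x) → Thin m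
leaf-thin (var i) (here refl) v w v-occurs w-occurs =
  FinP.toℕ-injective (trans (occurs-varMono (toℕ i) {v} v-occurs) (sym (occurs-varMono (toℕ i) {w} w-occurs)))
leaf-thin (const c) m∈ with c ℚP.≟ 0ℚ
leaf-thin (const c) (here refl) | no _ = λ v w v-occurs _ → ⊥-elim (v-occurs (lookup-𝟏 v))

leaf-nonNeg : ∀ {N} (x : Leaf N) → (∀ c → x ≡ const c → 0ℚ ℚ.≤ c) → NonNeg (leafPoly x)
leaf-nonNeg (var i) _ = 0≤1 ∷ []
leaf-nonNeg (const c) 0≤ = 0≤ c refl ∷ []

theorem1 : (k : ℕ) → 0 < k →
    Σ ℕ (λ ℓ₀ → 0 < ℓ₀ ×
    ((ℓ : ℕ) → ℓ₀ < ℓ → (C : Circuit (ℓ ^ (2 * k))) →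
    Monotone C → width C ≡ k →
    circuitPoly C ⊆mon P ℓ k →
    numMon (P ℓ k) ≤ 2 * numMon (circuitPoly C) →
    2 ^ ℓ ≤ 10 * size C))
-- At width `suc k` the descent excludes at most `k + 2` terms, and `excess-bound` requires twice
-- that number to be below `ℓ`.
theorem1 (suc k) _ = 2 * suc (suc k) , s≤s z≤n , bound
  where
  bound : (ℓ : ℕ) → 2 * suc (suc k) < ℓ → (C : Circuit (ℓ ^ (2 * suc k))) →
          Monotone C → width C ≡ suc k → circuitPoly C ⊆mon P ℓ (suc k) →
          numMon (P ℓ (suc k)) ≤ 2 * numMon (circuitPoly C) → 2 ^ ℓ ≤ 10 * size C
  bound ℓ large C monotone width≡ sub dense =
    result (Fin.splitAt (m₁ C) (output C)) (VecP.lookup-splitAt (m₁ C) lv (evalLayers lv [] (layers C)) (output C))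
    where
    lv = Vec.map leafPoly (leaves C)
    f = circuitPoly C
    2≤ℓ : 2 ≤ ℓ
    2≤ℓ = ≤-trans (≤-trans (s≤s (s≤s z≤n)) (m≤m+n (suc (suc k)) _)) (<⇒≤ large)
    0<ℓ : 0 < ℓ
    0<ℓ = ≤-trans (s≤s z≤n) 2≤ℓ

    lookup-lv : ∀ i → lookup lv i ≡ leafPoly (lookup (leaves C) i)
    lookup-lv i = VecP.lookup-map i leafPoly (leaves C)

    lv≥0 : ∀ i → NonNeg (lookup lv i)
    lv≥0 i = subst NonNeg (sym (lookup-lv i)) (leaf-nonNeg (lookup (leaves C) i) (monotone i))

    thin : ∀ i {m} → m ∈ leafSets lv i → Thin m
    thin i {m} m∈ = leaf-thin (lookup (leaves C) i) (subst (λ p → m ∈ support p) (lookup-lv i) m∈)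

    count-dense : count ℓ (suc k) ≤ 2 * card (support f)
    count-dense = ≤-trans (count≤numMon ℓ k 0 0<ℓ ≤-refl) (≤-trans dense (*-monoʳ-≤ 2 (numMon≤card f)))

    support⊆mons : NonNeg f → support f ⊆ mons ℓ (suc k) 0
    support⊆mons f≥0 {m} m∈ = subst (m ∈_) (support-Ppoly ℓ k 0)
      (mon⇒support (P ℓ (suc k)) (sub m (support⇒mon f≥0 m∈)))

    result : ∀ s → f ≡ [ lookup lv , lookup (evalLayers lv [] (layers C)) ]′ s → 2 ^ ℓ ≤ 10 * size C
    -- A leaf cannot be the output: by density its support is nonempty, and the monomials of the
    -- target are not thin.
    result (inj₁ i) f≡ with nonempty (support f) (≤-trans (count>0 0<ℓ (suc k)) count-dense)
    ... | x , xs , S≡ with subst (x ∈_) (sym S≡) (here refl)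
    ... | x∈ with ∈-concat-map⁻ (term ℓ k 0) (upTo ℓ) (support⊆mons (subst NonNeg (sym f≡) (lv≥0 i)) x∈)
    ... | τ , τ∈ , x∈τ = contradiction (thin i (subst (λ p → x ∈ support p) f≡ x∈))
      (term-¬thin ℓ k 0 2≤ℓ ≤-refl (∈-upTo⁻ τ∈) x∈τ)
    result (inj₂ o) f≡ with tower lv ∅ [] (λ ()) tt (layers C) (≤-reflexive width≡) o
    ... | w , t , h , set≡ , nar , t≤ = ≤-trans
      (lowerBound ℓ (suc k) large 0 ≤-refl (leafSets lv) thin t nar h
        (λ {m} m∈ → support⊆mons f≥0 (subst (m ∈_) set≡f m∈))
        (subst (λ S → count ℓ (suc k) ≤ 2 * card S) (sym set≡f) count-dense))
      -- The tower argument gives the constant 2, here relaxed to 10; the leaves only add to the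
      -- size.
      (*-mono-≤ (m≤m+n 2 8) (≤-trans t≤ (m≤n+m _ (m₁ C))))
      where
      f≥0 : NonNeg f
      f≥0 = subst NonNeg (sym f≡) (nonNeg-layers lv lv≥0 [] (λ ()) (layers C) o)
      set≡f : set (leafSets lv) t h ≡ support f
      set≡f = trans set≡ (cong support (sym f≡))
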